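{- Let $G\le\mathrm{Sym}(\Omega)$ be a primitive solvable permutation group and $\mathcal X=\mathrm{Inv}(G)$. Then $\mathcal X$ has a (possibly equal to $\mathcal X$) fusion isomorphic to $\mathcal Y\uparrow L$, where $\mathcal Y$ is a linearly primitive scheme and $L$ is a transitive permutation group. Moreover, if $\mathcal X$ is antisymmetric, then $\mathcal Y$ is antisymmetric and $L$ has odd order.
   Context: A coherent configuration on a finite set $\Omega$ is $\mathcal X=(\Omega,S)$ with $S$ a partition of $\Omega\times\Omega$ such that $1_\Omega$ is a union of elements of $S$, $s^*=\{(\beta,\alpha):(\alpha,\beta)\in s\}\in S$ for $s\in S$, and for $r,s,t\in S$ the number $|\{\gamma:(\alpha,\gamma)\in r,(\gamma,\beta)\in s\}|$ is independent of $(\alpha,\beta)\in t$; it is a scheme if $1_\Omega\in S$, antisymmetric if every $s\in S$ with $s=s^*$ lies in $1_\Omega$. $\mathcal X'$ is a fusion of $\mathcal X$ if every union of elements of $S'$ is a union of elements of $S$. $\mathrm{Inv}(G)=(\Omega,\text{orbits of }G\text{ on }\Omega\times\Omega)$. If $G$ is a primitive solvable permutation group on $\Omega$, then $\Omega$ can be identified with a vector space $\mathbb F_p^d$ so that $G\le\mathrm{AGL}(d,p)$ contains all translations and the stabilizer $K\le \mathrm{GL}(d,p)$ of the zero vector is irreducible; the scheme $\mathrm{Inv}(G)$ is called linearly primitive if $K$ is a primitive linear group (does not permute the summands of any decomposition $\mathbb F_p^d=V_1\oplus\dots\oplus V_t$, $t>1$, of nonzero subspaces). Exponentiation: for a coherent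 configuration $\mathcal Y=(\Gamma,T)$ and $L\le\mathrm{Sym}(\{1,\dots,m\})$, for $t_1,\dots,t_m\in T$ put $t_1\otimes\dots\otimes t_m=\{(\alpha,\beta)\in\Gamma^m\times\Gamma^m:(\alpha_i,\beta_i)\in t_i\ \forall i\}$; $L$ acts on $\Gamma^m$ by permuting coordinates and hence on such relations; $\mathcal Y\uparrow L=(\Gamma^m,\{\bigcup_{l\in L}t^l: t=t_1\otimes\dots\otimes t_m,\ t_i\in T\})$, a coherent configuration. -}

module Defs where

open import Level using (0ℓ)
open import Data.Bool using (Bool; T; _∧_)
open import Data.Bool.Properties using (T?)
open import Data.Fin using (Fin; toℕ)
import Data.Fin.Properties as Fin
import Data.Fin.Subset as Subset
open import Data.Nat using (ℕ; zero; suc; NonZero; _+_; _*_; _<_)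
open import Data.Nat.Divisibility using (_∣_)
open import Data.Nat.DivMod using (_mod_)
open import Data.Nat.Primality using (Prime; prime⇒nonZero)
open import Data.Product using (Σ-syntax; ∃; ∃₂; _×_; _,_)
open import Data.Sum using (_⊎_)
open import Data.Vec using (Vec; lookup; tabulate; replicate; zipWith; map)
open import Data.Vec.Properties using (lookup∘tabulate; tabulate∘lookup; tabulate-cong)
import Data.Vec.Functional as Functional
open import Function using (_∘_; _⇔_; _↔_; mk↔ₛ′; Inverse; Equivalence; mk⇔)
open import Function.Construct.Composition using (_↔-∘_)
open import Function.Construct.Identity using (↔-id)
open import Function.Construct.Symmetry using (↔-sym)
open import Function.Properties.Inverse using (↔⇒↣)
open import Relation.Binary.Definitions using (DecidableEquality)
open import Relation.Binary.PropositionalEquality using (_≡_; _≢_; refl; sym; trans; cong; subst)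
open import Relation.Nullary using (¬_; does)
open import Relation.Nullary.Decidable using (via-injection)
open import Relation.Unary using (Pred; Decidable; _∈_; _⊆_)

open Inverse using (to; from; strictlyInverseˡ; strictlyInverseʳ)

record FiniteSet : Set₁ where
  field
    Carrier : Set
    size    : ℕ
    enum    : Carrier ↔ Fin size

  _≟_ : DecidableEquality Carrier
  _≟_ = via-injection (↔⇒↣ enum) Fin._≟_

  count : (Carrier → Bool) → ℕ
  count p = Subset.∣ tabulate (p ∘ from enum) ∣

open FiniteSet public using (Carrier)

infix 4 _≗ₚ_

_≗ₚ_ : {A : Set} → A ↔ A → A ↔ A → Set
g ≗ₚ h = ∀ α → to g α ≡ to h α

-- Subgroups of Sym(A).  Decidability of membership is automatic classically;
-- `resp` makes membership depend on the underlying function only.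
record PermGroup (A : Set) : Set₁ where
  field
    Mem  : Pred (A ↔ A) 0ℓ
    mem? : Decidable Mem
    resp : ∀ {g h} → g ≗ₚ h → g ∈ Mem → h ∈ Mem
    id∈  : ↔-id A ∈ Mem
    ∘∈   : ∀ {g h} → g ∈ Mem → h ∈ Mem → g ↔-∘ h ∈ Mem
    inv∈ : ∀ {g} → g ∈ Mem → ↔-sym g ∈ Mem

open PermGroup public using (Mem)

module _ {A : Set} where

  Transitive : PermGroup A → Set
  Transitive G = ∀ α β → Σ[ g ∈ A ↔ A ] g ∈ Mem G × to g α ≡ β

  -- A nonempty B such that, for each g in G, either gB = B or gB ∩ B = ∅.
  IsBlock : PermGroup A → (A → Bool) → Set
  IsBlock G B =
    (Σ[ α ∈ A ] T (B α)) ×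
    (∀ g → g ∈ Mem G →
      (∀ α → T (B α) ⇔ T (B (to g α))) ⊎ (∀ α → T (B α) → ¬ T (B (to g α))))

  record Primitive (G : PermGroup A) : Set where
    field
      nontrivial : ∃₂ λ (α β : A) → α ≢ β
      transitive : Transitive G
      blocks     : ∀ B → IsBlock G B →
                   (∀ α β → T (B α) → T (B β) → α ≡ β) ⊎ (∀ α → T (B α))

  data Derived (H : Pred (A ↔ A) 0ℓ) : Pred (A ↔ A) 0ℓ where
    commutator : ∀ {g h} → g ∈ H → h ∈ H →
                 (↔-sym g ↔-∘ (↔-sym h ↔-∘ (g ↔-∘ h))) ∈ Derived H
    identity   : ↔-id A ∈ Derived H
    product    : ∀ {g h} → g ∈ Derived H → h ∈ Derived H → g ↔-∘ h ∈ Derived H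
    inverse    : ∀ {g} → g ∈ Derived H → ↔-sym g ∈ Derived H
    respects   : ∀ {g h} → g ≗ₚ h → g ∈ Derived H → h ∈ Derived H

  derivedSeries : PermGroup A → ℕ → Pred (A ↔ A) 0ℓ
  derivedSeries G zero    = Mem G
  derivedSeries G (suc k) = Derived (derivedSeries G k)

  Solvable : PermGroup A → Set
  Solvable G = ∃ λ k → ∀ g → g ∈ derivedSeries G k → g ≗ₚ ↔-id A

  HasOrder : PermGroup A → ℕ → Set
  HasOrder G k = Σ[ e ∈ (Fin k → A ↔ A) ]
    (∀ i → e i ∈ Mem G) ×
    (∀ i j → e i ≗ₚ e j → i ≡ j) ×
    (∀ g → g ∈ Mem G → ∃ λ i → e i ≗ₚ g)

  OddOrder : PermGroup A → Set
  OddOrder G = ∃ λ k → HasOrder G k × ¬ (2 ∣ k)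

  Stabilizer : Pred (A ↔ A) 0ℓ → A → Pred (A ↔ A) 0ℓ
  Stabilizer H α g = g ∈ H × to g α ≡ α

-- The group G carried over from A to B along φ.
Transport : {A B : Set} → A ↔ B → PermGroup A → Pred (B ↔ B) 0ℓ
Transport φ G h = (↔-sym φ ↔-∘ (h ↔-∘ φ)) ∈ Mem G

Relation : Set → Set
Relation A = A → A → Bool

infix 4 _≐_

_≐_ : {A : Set} → Relation A → Relation A → Set
r ≐ s = ∀ α β → r α β ≡ s α β

_* : {A : Set} → Relation A → Relation A
(s *) α β = s β α

-- s^f = {(f α , f β) : (α , β) ∈ s}
image : {A B : Set} → A ↔ B → Relation A → Relation B
image f s α β = s (from f α) (from f β)

record RelationSet (A : Set) : Set₁ where
  field
    Rel  : Pred (Relation A) 0ℓ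
    resp : ∀ {r s} → r ≐ s → r ∈ Rel → s ∈ Rel

open RelationSet public using (Rel)

module _ {A : Set} where

  IsUnion : RelationSet A → Relation A → Set₁
  IsUnion X u = Σ[ P ∈ Pred (Relation A) 0ℓ ]
    P ⊆ Rel X × (∀ α β → T (u α β) ⇔ (Σ[ s ∈ Relation A ] s ∈ P × T (s α β)))

  Isomorphic : {B : Set} → RelationSet A → RelationSet B → Set
  Isomorphic {B} X Y = Σ[ f ∈ A ↔ B ]
    (∀ t → t ∈ Rel Y ⇔ (Σ[ s ∈ Relation A ] s ∈ Rel X × t ≐ image f s))

  Inv : PermGroup A → RelationSet A
  Inv G = record
    { Rel  = λ r → ∃₂ λ α β → ∀ γ δ →
               T (r γ δ) ⇔ (Σ[ g ∈ A ↔ A ] g ∈ Mem G × to g α ≡ γ × to g β ≡ δ)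
    ; resp = λ r≐s (α , β , orbit) → α , β , λ γ δ → mk⇔
        (Equivalence.to (orbit γ δ) ∘ subst T (sym (r≐s γ δ)))
        (subst T (r≐s γ δ) ∘ Equivalence.from (orbit γ δ))
    }

module _ (Ω : FiniteSet) where
  open FiniteSet Ω using (_≟_; count)

  diagonal : Relation (Carrier Ω)
  diagonal α β = does (α ≟ β)

  record IsCoherent (X : RelationSet (Carrier Ω)) : Set₁ where
    field
      nonempty      : ∀ {s} → s ∈ Rel X → ∃₂ λ α β → T (s α β)
      covering      : ∀ α β → Σ[ s ∈ Relation (Carrier Ω) ] s ∈ Rel X × T (s α β)
      disjoint      : ∀ {r s} → r ∈ Rel X → s ∈ Rel X →
                      ∀ {α β} → T (r α β) → T (s α β) → r ≐ s
      diagonalUnion : IsUnion X diagonal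
      transpose     : ∀ {s} → s ∈ Rel X → s * ∈ Rel X
      intersection  : ∀ {r s t} → r ∈ Rel X → s ∈ Rel X → t ∈ Rel X →
                      ∀ {α β α′ β′} → T (t α β) → T (t α′ β′) →
                      count (λ γ → r α γ ∧ s γ β) ≡ count (λ γ → r α′ γ ∧ s γ β′)

  record IsScheme (X : RelationSet (Carrier Ω)) : Set₁ where
    field
      coherent  : IsCoherent X
      diagonal∈ : diagonal ∈ Rel X

  Antisymmetric : RelationSet (Carrier Ω) → Set
  Antisymmetric X = ∀ s → s ∈ Rel X → s ≐ s * → ∀ α β → T (s α β) → T (diagonal α β)

  record IsFusion (X′ X : RelationSet (Carrier Ω)) : Set₁ where
    field
      coherent′ : IsCoherent X′
      coherent  : IsCoherent X
      unions    : ∀ u → IsUnion X′ u → IsUnion X u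

⨂ : {A : Set} {m : ℕ} → (Fin m → Relation A) → Relation (Vec A m)
⨂ t α β = does (Fin.all? λ i → T? (t i (lookup α i) (lookup β i)))

-- The i-th coordinate of α becomes the (l i)-th coordinate of the image.
permuteCoordinates : {A : Set} {m : ℕ} → Fin m ↔ Fin m → Vec A m ↔ Vec A m
permuteCoordinates {A} {m} l =
  mk↔ₛ′ (act (from l)) (act (to l))
    (act-inverse (from l) (to l) (strictlyInverseˡ l))
    (act-inverse (to l) (from l) (strictlyInverseʳ l))
  where
  act : (Fin m → Fin m) → Vec A m → Vec A m
  act k α = tabulate (λ i → lookup α (k i))

  act-inverse : ∀ j k → (∀ i → k (j i) ≡ i) → ∀ α → act j (act k α) ≡ α
  act-inverse j k kj α = trans
    (tabulate-cong λ i → trans (lookup∘tabulate _ (j i)) (cong (lookup α) (kj i)))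
    (tabulate∘lookup α)

infix 6 _↑_

_↑_ : {A : Set} {m : ℕ} → RelationSet A → PermGroup (Fin m) → RelationSet (Vec A m)
_↑_ {A} {m} Y L = record
  { Rel  = λ r → Σ[ t ∈ (Fin m → Relation A) ] (∀ i → t i ∈ Rel Y) ×
             (∀ α β → T (r α β) ⇔
               (Σ[ l ∈ Fin m ↔ Fin m ] l ∈ Mem L × T (image (permuteCoordinates l) (⨂ t) α β)))
  ; resp = λ r≐s (t , t∈ , union) → t , t∈ , λ α β → mk⇔
      (Equivalence.to (union α β) ∘ subst T (sym (r≐s α β)))
      (subst T (r≐s α β) ∘ Equivalence.from (union α β))
  }

-- 𝔽ₚ is Fin p with arithmetic modulo p; it is a field when p is prime.
module LinearAlgebra (p : ℕ) .{{_ : NonZero p}} (d : ℕ) where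

  𝔽 : Set
  𝔽 = Fin p

  V : Set
  V = Vec 𝔽 d

  𝟎 : V
  𝟎 = replicate d (0 mod p)

  infixl 6 _⊕_
  infixr 7 _·_

  _⊕_ : V → V → V
  _⊕_ = zipWith (λ a b → (toℕ a + toℕ b) mod p)

  _·_ : 𝔽 → V → V
  c · v = map (λ a → (toℕ c * toℕ a) mod p) v

  ∑ : {t : ℕ} → (Fin t → V) → V
  ∑ = Functional.foldr _⊕_ 𝟎

  IsLinear : V ↔ V → Set
  IsLinear g = (∀ u v → to g (u ⊕ v) ≡ to g u ⊕ to g v) × (∀ c v → to g (c · v) ≡ c · to g v)

  IsAffine : V ↔ V → Set
  IsAffine g = Σ[ a ∈ V ↔ V ] Σ[ b ∈ V ] IsLinear a × (∀ v → to g v ≡ to a v ⊕ b)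

  ContainsTranslations : Pred (V ↔ V) 0ℓ → Set
  ContainsTranslations H = ∀ b → Σ[ g ∈ V ↔ V ] g ∈ H × (∀ v → to g v ≡ v ⊕ b)

  record IsSubspace (W : V → Bool) : Set where
    field
      𝟎∈ : T (W 𝟎)
      ⊕∈ : ∀ {u v} → T (W u) → T (W v) → T (W (u ⊕ v))
      ·∈ : ∀ c {v} → T (W v) → T (W (c · v))

  record Irreducible (K : Pred (V ↔ V) 0ℓ) : Set where
    field
      nonzero    : Σ[ v ∈ V ] v ≢ 𝟎
      invariants : ∀ W → IsSubspace W → (∀ g → g ∈ K → ∀ v → T (W v) → T (W (to g v))) →
                   (∀ v → T (W v) → v ≡ 𝟎) ⊎ (∀ v → T (W v))

  record IsDecomposition {t : ℕ} (W : Fin t → V → Bool) : Set where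
    field
      subspace : ∀ i → IsSubspace (W i)
      nonzero  : ∀ i → Σ[ v ∈ V ] T (W i v) × v ≢ 𝟎
      spanning : ∀ v → Σ[ w ∈ (Fin t → V) ] (∀ i → T (W i (w i))) × ∑ w ≡ v
      unique   : ∀ w w′ → (∀ i → T (W i (w i))) → (∀ i → T (W i (w′ i))) →
                 ∑ w ≡ ∑ w′ → ∀ i → w i ≡ w′ i

  PermutesSummands : {t : ℕ} → Pred (V ↔ V) 0ℓ → (Fin t → V → Bool) → Set
  PermutesSummands K W = ∀ g → g ∈ K → ∀ i → ∃ λ j → ∀ v → T (W i v) ⇔ T (W j (to g v))

  IsPrimitiveLinear : Pred (V ↔ V) 0ℓ → Set
  IsPrimitiveLinear K =
    ∀ t → 1 < t → (W : Fin t → V → Bool) → IsDecomposition W → ¬ PermutesSummands K W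

-- X is Inv(G) for a primitive solvable group G whose point stabilizer, after an
-- identification φ of the points with 𝔽ₚᵈ making G affine, is a primitive linear group.
record LinearlyPrimitive {A : Set} (X : RelationSet A) : Set₁ where
  field
    G           : PermGroup A
    isPrimitive : Primitive G
    isSolvable  : Solvable G
    X≡InvG      : ∀ s → s ∈ Rel X ⇔ s ∈ Rel (Inv G)
    p d         : ℕ
    prime       : Prime p

  open LinearAlgebra p {{prime⇒nonZero prime}} d

  field
    φ : A ↔ V

  G^φ : Pred (V ↔ V) 0ℓ
  G^φ = Transport φ G

  K : Pred (V ↔ V) 0ℓ
  K = Stabilizer G^φ 𝟎

  field
    affine          : ∀ g → g ∈ G^φ → IsAffine g
    translations    : ContainsTranslations G^φ
    irreducible     : Irreducible K
    linearPrimitive : IsPrimitiveLinear K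

{-# OPTIONS --safe #-}
-- The last nontrivial term of the derived series is an abelian normal subgroup; by primitivity it is
-- regular, so Ω becomes an elementary abelian group on which the stabilizer K of 0 acts irreducibly.
-- Among the decompositions of Ω into summands permuted by K take one with the maximal number t of
-- summands.  By irreducibility K is transitive on them, and moving all summands onto the first one, W,
-- identifies Ω with Wᵗ and embeds G into the wreath product, in product action, of the group H induced
-- on W by the setwise stabilizer of W in G with the group L induced by K on the summands.  The orbital
-- configuration of that wreath product is Inv(H) ↑ L.  A decomposition of W permuted by H₀ would refine
-- the chosen one, so H₀ is a primitive linear group.  If Inv(G) is antisymmetric, then no element of G
-- swaps two points; this passes to H, and it forces all cycles of elements of G to have odd length,
-- which excludes involutions in L.
module Submission where

open import Defs
open import Algebra.Bundles using (AbelianGroup)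
import Algebra.Properties.AbelianGroup as AbelianGroupProperties
import Algebra.Properties.CommutativeMonoid.Mult as Mult
import Algebra.Properties.CommutativeMonoid.Sum as FiniteSum
import Algebra.Properties.CommutativeSemigroup as CommutativeSemigroupProperties
open import Data.Bool using (Bool; true; false; T; _∧_)
open import Data.Bool.Properties using (T?)
open import Data.Fin using (Fin; zero; suc; toℕ; combine; remQuot)
import Data.Fin.Properties as Fin
import Data.Fin.Subset as Subset
open import Data.List using ([]; _∷_)
open import Data.List.Relation.Unary.All using (All; []; _∷_)
import Data.Nat as ℕ
open import Data.Nat using (ℕ; zero; suc; _≤_; _<_; pred; NonZero; z≤n; s≤s)
open import Data.Nat.Coprimality using (prime⇒coprime; coprime-Bézout)
open import Data.Nat.DivMod using (_mod_; _/_; _%_; m≡m%n+[m/n]*n; m%n<n)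
open import Data.Nat.Divisibility using (_∣_; ∣m+n∣m⇒∣n; ∣1⇒≡1; n∣m*n)
open import Data.Nat.GCD using (module Bézout)
open import Data.Nat.Induction using (<-wellFounded; Acc; acc)
open import Data.Nat.ListAction using () renaming (product to ∏)
open import Data.Nat.Primality using (Prime; prime⇒nonZero)
open import Data.Nat.Primality.Factorisation using (PrimeFactorisation; factorise)
import Data.Nat.Properties as ℕ
open import Data.Product using (Σ; Σ-syntax; ∃; ∃₂; _×_; _,_; proj₁; proj₂; curry; uncurry)
open import Data.Product.Function.NonDependent.Propositional using (_×-↔_)
open import Data.Sum as Sum using (_⊎_; inj₁; inj₂)
open import Data.Unit using (tt)
open import Data.Vec using (Vec; []; _∷_; head; tail; lookup; tabulate)
open import Data.Vec.Properties using (lookup∘tabulate; tabulate∘lookup; tabulate-cong)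
open import Function using (_∘_; _⇔_; _↔_; mk↔ₛ′; Inverse; Equivalence; mk⇔; id)
open import Function.Construct.Composition using (_↔-∘_)
open import Function.Construct.Identity using (↔-id)
open import Function.Construct.Symmetry using (↔-sym)
open import Level using (0ℓ)
open import Relation.Binary.Definitions using (tri<; tri≈; tri>)
open import Relation.Binary.PropositionalEquality using (_≡_; _≢_; _≗_; refl; sym; trans; cong; cong₂; subst; isEquivalence; module ≡-Reasoning)
open import Relation.Nullary using (¬_; Dec; yes; no; does; contradiction)
open import Relation.Nullary.Decidable using (map′; ¬?; decidable-stable; _×-dec_; _→-dec_; _⊎-dec_; dec-true; dec-false; ¬¬-excluded-middle)
open import Relation.Unary using (Pred; Decidable; _∈_; _⊆_)

open Inverse using (to; from; strictlyInverseˡ; strictlyInverseʳ)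

-- The argument has to be carried out constructively. A term of the derived series is an inductively
-- generated predicate with no decision procedure for membership, while primitivity speaks only of
-- `Bool`-valued blocks. The normal subgroup is therefore obtained only under double negation, and
-- what is kept of it is its addition table on the points: a finite object whose existence is
-- decidable, so that the double negation can be removed. The same need explains why a decomposition
-- is given by its projections. These are maps on a finite set subject to pointwise equations, so
-- the possible numbers of summands can be tested one by one and a largest one exists. Linear
-- algebra enters late. Until then there are only natural multiples in an abelian group of exponent
-- `p`, and a basis is chosen for a single summand. Over a prime field every additive map is linear
-- and every subgroup is a subspace, so scalars never need separate treatment.

private module ℕSum = FiniteSum ℕ.+-0-commutativeMonoid

-- Search over finite types

Search : Set → Set₁
Search A = {P : Pred A 0ℓ} → Decidable P → Dec (∃ P)

opaque
  search⇒all? : {A : Set} → Search A → {P : Pred A 0ℓ} → Decidable P → Dec (∀ x → P x)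
  search⇒all? search P? = map′
    (λ none x → decidable-stable (P? x) λ ¬Px → none (x , ¬Px))
    (λ all (x , ¬Px) → ¬Px (all x))
    (¬? (search (¬? ∘ P?)))

opaque
  searchVec : {A : Set} → Search A → ∀ n → Search (Vec A n)
  searchVec search zero    P? = map′ ([] ,_) (λ { ([] , p) → p }) (P? [])
  searchVec search (suc n) P? = map′
    (λ (x , xs , p) → x ∷ xs , p)
    (λ { (x ∷ xs , p) → x , xs , p })
    (search λ x → searchVec search n (P? ∘ (x ∷_)))

module _ (Ω : FiniteSet) where
  open FiniteSet Ω using (_≟_; enum; size)
  private A = Carrier Ω

  opaque
    searchCarrier : Search A
    searchCarrier {P} P? = map′
      (λ (i , p) → from enum i , p)
      (λ (x , p) → to enum x , subst P (sym (strictlyInverseʳ enum x)) p)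
      (Fin.any? (P? ∘ from enum))

  all? : {P : Pred A 0ℓ} → Decidable P → Dec (∀ x → P x)
  all? = search⇒all? searchCarrier

  opaque
    -- A map is searched for through its table of values and is recovered from it only pointwise;
    -- this is the reason for the hypothesis on `_≗_`.
    searchMaps : {B : Set} → Search B → {P : Pred (A → B) 0ℓ} →
                 (∀ {f g} → f ≗ g → P f → P g) → Decidable P → Dec (∃ P)
    searchMaps {B} search {P} resp P? = map′
      (λ (v , p) → read v , p)
      (λ (f , p) → tabulate (f ∘ from enum) , resp (sym ∘ read-tabulate f) p)
      (searchVec search size (P? ∘ read))
      where
      read : Vec B size → A → B
      read v = lookup v ∘ to enum
      read-tabulate : ∀ f → read (tabulate (f ∘ from enum)) ≗ f
      read-tabulate f x = trans (lookup∘tabulate _ (to enum x)) (cong f (strictlyInverseʳ enum x))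

  opaque
    -- The search runs over pairs of maps `f`, `f⁻¹`. The proofs of the inverse laws are whatever
    -- `all?` returns, so the hypothesis is also what carries `P` between permutations that differ
    -- only in those proofs.
    searchPermutations : {P : Pred (A ↔ A) 0ℓ} →
                         (∀ {g h} → g ≗ₚ h → P g → P h) → Decidable P → Dec (∃ P)
    searchPermutations {P} resp P? = map′
      (λ (f , f⁻¹ , l , r , p) → mk↔ₛ′ f f⁻¹ l r , p)
      (λ (g , p) → to g , from g , strictlyInverseˡ g , strictlyInverseʳ g , resp (λ _ → refl) p)
      (searchMaps searchCarrier
        (λ f≗g (f⁻¹ , l , r , p) → f⁻¹ , (λ x → trans (sym (f≗g _)) (l x)) ,
          (λ x → trans (cong f⁻¹ (sym (f≗g x))) (r x)) , resp f≗g p)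
        λ f → searchMaps searchCarrier
          (λ {f⁻¹} {g⁻¹} f≗g (l , r , p) → (λ x → trans (cong f (sym (f≗g x))) (l x)) ,
            (λ x → trans (sym (f≗g _)) (r x)) , resp (λ _ → refl) p)
          λ f⁻¹ → dec f f⁻¹)
      where
      dec : ∀ f f⁻¹ → Dec (Σ[ l ∈ (∀ x → f (f⁻¹ x) ≡ x) ] Σ[ r ∈ (∀ x → f⁻¹ (f x) ≡ x) ]
                           P (mk↔ₛ′ f f⁻¹ l r))
      dec f f⁻¹ with all? (λ x → f (f⁻¹ x) ≟ x) | all? (λ x → f⁻¹ (f x) ≟ x)
      ... | no ¬l | _     = no (¬l ∘ proj₁)
      ... | yes _ | no ¬r = no (¬r ∘ proj₁ ∘ proj₂)
      ... | yes l | yes r = map′ (λ p → l , r , p)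
        (λ (_ , _ , p) → resp (λ _ → refl) p) (P? (mk↔ₛ′ f f⁻¹ l r))

  opaque
    anyPermutation : (G : PermGroup A) {P : Pred (A ↔ A) 0ℓ} →
                     (∀ {g h} → g ≗ₚ h → P g → P h) → Decidable P →
                     Dec (Σ[ g ∈ A ↔ A ] g ∈ Mem G × P g)
    anyPermutation G resp P? = searchPermutations
      (λ g≗h (g∈ , p) → PermGroup.resp G g≗h g∈ , resp g≗h p)
      (λ g → PermGroup.mem? G g ×-dec P? g)

  opaque
    allPermutations : (G : PermGroup A) {P : Pred (A ↔ A) 0ℓ} →
                      (∀ {g h} → g ≗ₚ h → P g → P h) → Decidable P →
                      Dec (∀ g → g ∈ Mem G → P g)
    allPermutations G resp P? = map′
      (λ none g g∈ → decidable-stable (P? g) λ ¬Pg → none (g , g∈ , ¬Pg))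
      (λ all (g , g∈ , ¬Pg) → ¬Pg (all g g∈))
      (¬? (anyPermutation G (λ g≗h ¬Pg Ph → ¬Pg (resp (sym ∘ g≗h) Ph)) (¬? ∘ P?)))

-- Orbital configurations

T⇔⇒≡ : ∀ {x y} → T x ⇔ T y → x ≡ y
T⇔⇒≡ {false} {false} _ = refl
T⇔⇒≡ {true}  {true}  _ = refl
T⇔⇒≡ {false} {true}  e with () ← Equivalence.from e tt
T⇔⇒≡ {true}  {false} e with () ← Equivalence.to e tt

T-does : {P : Set} (P? : Dec P) → T (does P?) ⇔ P
T-does (yes p) = mk⇔ (λ _ → p) (λ _ → tt)
T-does (no ¬p) = mk⇔ (λ ()) ¬p

module _ {A : Set} (G : PermGroup A) where

  SameOrbit : A → A → A → A → Set
  SameOrbit α β γ δ = Σ[ g ∈ A ↔ A ] g ∈ Mem G × to g α ≡ γ × to g β ≡ δ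

  same-refl : ∀ {α β} → SameOrbit α β α β
  same-refl = ↔-id _ , PermGroup.id∈ G , refl , refl

  same-sym : ∀ {α β γ δ} → SameOrbit α β γ δ → SameOrbit γ δ α β
  same-sym (g , g∈ , refl , refl) =
    ↔-sym g , PermGroup.inv∈ G g∈ , strictlyInverseʳ g _ , strictlyInverseʳ g _

  same-trans : ∀ {α β γ δ ε ζ} → SameOrbit α β γ δ → SameOrbit γ δ ε ζ → SameOrbit α β ε ζ
  same-trans (g , g∈ , refl , refl) (h , h∈ , refl , refl) =
    h ↔-∘ g , PermGroup.∘∈ G h∈ g∈ , refl , refl

  orbital-invariant : ∀ {r} → r ∈ Rel (Inv G) → ∀ {g} → g ∈ Mem G →
                      ∀ α β → r (to g α) (to g β) ≡ r α β
  orbital-invariant (α₀ , β₀ , orbit) {g} g∈ α β = T⇔⇒≡ (mk⇔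
    (λ p → Equivalence.from (orbit α β)
      (same-trans (Equivalence.to (orbit _ _) p) (same-sym (g , g∈ , refl , refl))))
    (λ p → Equivalence.from (orbit _ _)
      (same-trans (Equivalence.to (orbit α β) p) (g , g∈ , refl , refl))))

  orbital-orbit : ∀ {r} → r ∈ Rel (Inv G) → ∀ {α β γ δ} → T (r α β) → T (r γ δ) → SameOrbit α β γ δ
  orbital-orbit (_ , _ , orbit) p q =
    same-trans (same-sym (Equivalence.to (orbit _ _) p)) (Equivalence.to (orbit _ _) q)

boolToℕ : Bool → ℕ
boolToℕ false = 0
boolToℕ true  = 1

module _ (Ω : FiniteSet) where
  open FiniteSet Ω using (_≟_; enum; size; count)
  private A = Carrier Ω

  diagonal⇔≡ : ∀ {α β} → T (diagonal Ω α β) ⇔ α ≡ β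
  diagonal⇔≡ {α} {β} = T-does (α ≟ β)

  count-sum : ∀ p → count p ≡ ℕSum.sum (boolToℕ ∘ p ∘ from enum)
  count-sum p = go (p ∘ from enum)
    where
    go : ∀ {n} (q : Fin n → Bool) → Subset.∣ tabulate q ∣ ≡ ℕSum.sum (boolToℕ ∘ q)
    go {zero}  q = refl
    go {suc n} q with q zero
    ... | true  = cong suc (go (q ∘ suc))
    ... | false = go (q ∘ suc)

  -- A cardinality written as a sum of indicators is invariant under the reindexing that `g` induces
  -- on the enumeration. It yields the intersection numbers of `Inv G`.
  count-permute : ∀ p q (g : A ↔ A) → (∀ γ → q (to g γ) ≡ p γ) → count p ≡ count q
  count-permute p q g q∘g≡p = begin
    count p                                  ≡⟨ count-sum p ⟩
    ℕSum.sum (boolToℕ ∘ p ∘ from enum)             ≡⟨ ℕSum.sum-cong-≗ (λ i → cong boolToℕ (trans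
                                                  (sym (q∘g≡p (from enum i)))
                                                  (cong q (sym (strictlyInverseʳ enum _))))) ⟩
    ℕSum.sum (boolToℕ ∘ q ∘ from enum ∘ to σ)      ≡⟨ ℕSum.sum-permute (boolToℕ ∘ q ∘ from enum) σ ⟨
    ℕSum.sum (boolToℕ ∘ q ∘ from enum)             ≡⟨ count-sum q ⟨
    count q                                  ∎
    where
    open ≡-Reasoning
    σ : Fin size ↔ Fin size
    σ = enum ↔-∘ (g ↔-∘ ↔-sym enum)

  module _ (G : PermGroup A) where

    opaque
      sameOrbit? : ∀ α β γ δ → Dec (SameOrbit G α β γ δ)
      sameOrbit? α β γ δ = anyPermutation Ω G
        (λ g≗h (p , q) → trans (sym (g≗h α)) p , trans (sym (g≗h β)) q)
        (λ g → (to g α ≟ γ) ×-dec (to g β ≟ δ))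

    orbital : A → A → Relation A
    orbital α β γ δ = does (sameOrbit? α β γ δ)

    orbital∈ : ∀ α β → orbital α β ∈ Rel (Inv G)
    orbital∈ α β = α , β , λ γ δ → T-does (sameOrbit? α β γ δ)

    orbital-self : ∀ α β → T (orbital α β α β)
    orbital-self α β = Equivalence.from (T-does (sameOrbit? α β α β)) (same-refl G)

    Inv-coherent : IsCoherent Ω (Inv G)
    Inv-coherent = record
      { nonempty      = λ (α , β , orbit) → α , β , Equivalence.from (orbit α β) (same-refl G)
      ; covering      = λ α β → orbital α β , orbital∈ α β , orbital-self α β
      ; disjoint      = λ { (_ , _ , orbit) (_ , _ , orbit′) p q γ δ → T⇔⇒≡ (mk⇔
          (λ t → Equivalence.from (orbit′ γ δ) (same-trans G
            (Equivalence.to (orbit′ _ _) q)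
            (same-trans G (same-sym G (Equivalence.to (orbit _ _) p)) (Equivalence.to (orbit γ δ) t))))
          (λ t → Equivalence.from (orbit γ δ) (same-trans G
            (Equivalence.to (orbit _ _) p)
            (same-trans G (same-sym G (Equivalence.to (orbit′ _ _) q)) (Equivalence.to (orbit′ γ δ) t))))) }
      -- The union is taken over all orbitals contained in the diagonal.
      ; diagonalUnion =
          (λ s → s ∈ Rel (Inv G) × (∀ α β → T (s α β) → α ≡ β)) , proj₁ ,
          λ α β → mk⇔
            (λ p → orbital α β , (orbital∈ α β , λ γ δ t →
              diagonal-orbit (Equivalence.to diagonal⇔≡ p)
                (Equivalence.to (T-does (sameOrbit? α β γ δ)) t)) , orbital-self α β)
            (λ (s , (_ , s⊆) , t) → Equivalence.from diagonal⇔≡ (s⊆ α β t))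
      ; transpose     = λ (α , β , orbit) → β , α , λ γ δ → mk⇔
          (λ t → swap (Equivalence.to (orbit δ γ) t))
          (λ t → Equivalence.from (orbit δ γ) (swap t))
      ; intersection  = λ r∈ s∈ t∈ p q → intersect r∈ s∈ (orbital-orbit G t∈ p q)
      }
      where
      diagonal-orbit : ∀ {α β γ δ} → α ≡ β → SameOrbit G α β γ δ → γ ≡ δ
      diagonal-orbit refl (g , _ , refl , refl) = refl
      swap : ∀ {α β γ δ} → SameOrbit G α β γ δ → SameOrbit G β α δ γ
      swap (g , g∈ , p , q) = g , g∈ , q , p
      intersect : ∀ {r s} → r ∈ Rel (Inv G) → s ∈ Rel (Inv G) → ∀ {α β α′ β′} → SameOrbit G α β α′ β′ →
                  count (λ γ → r α γ ∧ s γ β) ≡ count (λ γ → r α′ γ ∧ s γ β′)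
      intersect {r} {s} r∈ s∈ {α} {β} (g , g∈ , refl , refl) = count-permute _
        (λ γ → r (to g α) γ ∧ s γ (to g β)) g λ γ →
        cong₂ _∧_ (orbital-invariant G r∈ g∈ α γ) (orbital-invariant G s∈ g∈ γ β)

    Inv-scheme : Transitive G → A → IsScheme Ω (Inv G)
    Inv-scheme transitive α = record
      { coherent  = Inv-coherent
      ; diagonal∈ = α , α , λ γ δ → mk⇔
          (λ t → let (g , g∈ , gα) = transitive α γ in
            g , g∈ , gα , trans gα (Equivalence.to diagonal⇔≡ t))
          (λ (g , _ , p , q) → Equivalence.from diagonal⇔≡ (trans (sym p) q))
      }

    -- An element exchanging `α` and `β` makes the orbital of the pair symmetric, and then
    -- antisymmetry puts it inside the diagonal. The later arguments use antisymmetry in this form,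
    -- which passes directly to groups induced on subsets.
    Inv-antisymmetric⇒noSwap : Antisymmetric Ω (Inv G) → ∀ {g α β} → g ∈ Mem G →
                               to g α ≡ β → to g β ≡ α → α ≡ β
    Inv-antisymmetric⇒noSwap anti {g} {α} {β} g∈ gα gβ = Equivalence.to diagonal⇔≡
      (anti (orbital α β) (orbital∈ α β) (λ γ δ → T⇔⇒≡ (mk⇔ (flip γ δ) (flip δ γ)))
        α β (orbital-self α β))
      where
      flip : ∀ γ δ → T (orbital α β γ δ) → T (orbital α β δ γ)
      flip γ δ t with h , h∈ , hα , hβ ← Equivalence.to (T-does (sameOrbit? α β γ δ)) t =
        Equivalence.from (T-does (sameOrbit? α β δ γ))
          (same-trans G (g , g∈ , gα , gβ) (h , h∈ , hβ , hα))

    noSwap⇒Inv-antisymmetric : (∀ {g α β} → g ∈ Mem G → to g α ≡ β → to g β ≡ α → α ≡ β) →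
                               Antisymmetric Ω (Inv G)
    noSwap⇒Inv-antisymmetric noSwap s s∈ s≐s* α β t
      with g , g∈ , p , q ← orbital-orbit G s∈ t (subst T (s≐s* α β) t) =
      Equivalence.from diagonal⇔≡ (noSwap g∈ p q)

  -- A larger group has coarser orbitals. A union `u` of orbitals of `Ĝ` is invariant under `G`,
  -- hence is the union of all orbitals of `G` contained in `u`.
  Inv-fusion : (G Ĝ : PermGroup A) → Mem G ⊆ Mem Ĝ → IsFusion Ω (Inv Ĝ) (Inv G)
  Inv-fusion G Ĝ G⊆Ĝ = record
    { coherent′ = Inv-coherent Ĝ
    ; coherent  = Inv-coherent G
    ; unions    = λ u (P , P⊆ , union) →
        (λ s → s ∈ Rel (Inv G) × (∀ α β → T (s α β) → T (u α β))) , proj₁ ,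
        λ α β → mk⇔
          (λ t → orbital G α β , (orbital∈ G α β , λ γ δ t′ →
            invariant P⊆ union t (Equivalence.to (T-does (sameOrbit? G α β γ δ)) t′)) ,
            orbital-self G α β)
          (λ (s , (_ , s⊆u) , t) → s⊆u α β t)
    }
    where
    invariant : ∀ {u : Relation A} {P : Pred (Relation A) 0ℓ} → P ⊆ Rel (Inv Ĝ) →
                (∀ α β → T (u α β) ⇔ (Σ[ s ∈ Relation A ] s ∈ P × T (s α β))) →
                ∀ {α β γ δ} → T (u α β) → SameOrbit G α β γ δ → T (u γ δ)
    invariant P⊆ union {α} {β} t (g , g∈ , refl , refl)
      with s , s∈ , t′ ← Equivalence.to (union α β) t =
      Equivalence.from (union _ _)
        (s , s∈ , subst T (sym (orbital-invariant Ĝ (P⊆ s∈) (G⊆Ĝ g∈) α β)) t′)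

-- Wreath products in product action

finSet : ℕ → FiniteSet
finSet m = record { Carrier = Fin m ; size = m ; enum = ↔-id (Fin m) }

vec-ext : {A : Set} {m : ℕ} {x y : Vec A m} → (∀ i → lookup x i ≡ lookup y i) → x ≡ y
vec-ext {x = x} {y} eq = trans (sym (tabulate∘lookup x)) (trans (tabulate-cong eq) (tabulate∘lookup y))

-- `image` pulls back along the inverse permutation of coordinates, and the `i`-th entry of that
-- inverse image is read at position `to l i`.
permuted-⨂⇔ : {A : Set} {m : ℕ} (l : Fin m ↔ Fin m) (t : Fin m → Relation A) → ∀ α β →
  T (image (permuteCoordinates l) (⨂ t) α β) ⇔
  (∀ i → T (t i (lookup α (to l i)) (lookup β (to l i))))
permuted-⨂⇔ {A} {m} l t α β = mk⇔
  (λ p i → subst T (entry i) (Equivalence.to tensor p i))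
  (λ p → Equivalence.from tensor λ i → subst T (sym (entry i)) (p i))
  where
  permuted : Vec A m → Vec A m
  permuted = from (permuteCoordinates l)
  tensor : T (⨂ t (permuted α) (permuted β)) ⇔
           (∀ i → T (t i (lookup (permuted α) i) (lookup (permuted β) i)))
  tensor = T-does (Fin.all? λ i → T? (t i (lookup (permuted α) i) (lookup (permuted β) i)))
  entry : ∀ i → t i (lookup (permuted α) i) (lookup (permuted β) i) ≡
                t i (lookup α (to l i)) (lookup β (to l i))
  entry i = cong₂ (t i) (lookup∘tabulate (lookup α ∘ to l) i) (lookup∘tabulate (lookup β ∘ to l) i)

module _ (Ω Γ : FiniteSet) {m : ℕ} (H : PermGroup (Carrier Γ)) (L : PermGroup (Fin m))
         (f : Carrier Ω ↔ Vec (Carrier Γ) m) where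
  private
    A = Carrier Ω
    module H = PermGroup H
    module L = PermGroup L

  coordinate : A → Fin m → Carrier Γ
  coordinate x i = lookup (to f x) i

  coordinate-ext : ∀ {x y} → (∀ i → coordinate x i ≡ coordinate y i) → x ≡ y
  coordinate-ext {x} {y} eq = trans (sym (strictlyInverseʳ f x))
    (trans (cong (from f) (vec-ext eq)) (strictlyInverseʳ f y))

  point : (Fin m → Carrier Γ) → A
  point a = from f (tabulate a)

  coordinate-point : ∀ a i → coordinate (point a) i ≡ a i
  coordinate-point a i = trans (cong (λ v → lookup v i) (strictlyInverseˡ f _)) (lookup∘tabulate a i)

  ActsAs : A ↔ A → Fin m ↔ Fin m → Fin m → Carrier Γ ↔ Carrier Γ → Set
  ActsAs g l i h = ∀ x → coordinate (to g x) (to l i) ≡ to h (coordinate x i)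

  -- One permutation of the coordinates from `L`, and for every coordinate its own element of `H`:
  -- the product action of the wreath product, carried over to `A` along `f`.
  InWreath : A ↔ A → Set
  InWreath g = Σ[ l ∈ Fin m ↔ Fin m ] l ∈ L.Mem ×
    (∀ i → Σ[ h ∈ Carrier Γ ↔ Carrier Γ ] h ∈ H.Mem × ActsAs g l i h)

  opaque
    inWreath? : Decidable InWreath
    inWreath? g = anyPermutation (finSet m) L
      (λ l≗l′ acts i → let (h , h∈ , eq) = acts i in
        h , h∈ , λ x → trans (cong (coordinate (to g x)) (sym (l≗l′ i))) (eq x))
      λ l → Fin.all? λ i → anyPermutation Γ H
        (λ h≗h′ eq x → trans (eq x) (h≗h′ _))
        λ h → all? Ω λ x → FiniteSet._≟_ Γ (coordinate (to g x) (to l i)) (to h (coordinate x i))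

  wreath : PermGroup A
  wreath = record
    { Mem  = InWreath
    ; mem? = inWreath?
    ; resp = λ g≗g′ (l , l∈ , acts) → l , l∈ , λ i → let (h , h∈ , eq) = acts i in
        h , h∈ , λ x → trans (cong (λ y → coordinate y (to l i)) (sym (g≗g′ x))) (eq x)
    ; id∈  = ↔-id _ , L.id∈ , λ i → ↔-id _ , H.id∈ , λ x → refl
    ; ∘∈   = λ { {g} {g′} (l , l∈ , acts) (l′ , l′∈ , acts′) → l ↔-∘ l′ , L.∘∈ l∈ l′∈ , λ i →
        let (h , h∈ , eq)    = acts (to l′ i)
            (h′ , h′∈ , eq′) = acts′ i
        in h ↔-∘ h′ , H.∘∈ h∈ h′∈ , λ x → trans (eq (to g′ x)) (cong (to h) (eq′ x)) }
    -- At coordinate `i` the inverse undoes the element by which `g` acted on coordinate `from l i`.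
    ; inv∈ = λ { {g} (l , l∈ , acts) → ↔-sym l , L.inv∈ l∈ , λ i →
        let j              = from l i
            (h , h∈ , eq) = acts j
        in ↔-sym h , H.inv∈ h∈ , λ x → trans (sym (strictlyInverseʳ h _)) (cong (from h)
             (trans (sym (eq (from g x)))
               (cong₂ coordinate (strictlyInverseˡ g x) (strictlyInverseˡ l i)))) }
    }

  -- Shows that the wreath product is full: the elements of `H` at different coordinates can be
  -- prescribed independently.
  assemble : (l : Fin m ↔ Fin m) → (Fin m → Carrier Γ ↔ Carrier Γ) → A ↔ A
  assemble l h = mk↔ₛ′ there back
    (λ x → coordinate-ext λ j → begin
      coordinate (there (back x)) j                             ≡⟨ coordinate-point _ j ⟩
      to (h (from l j)) (coordinate (back x) (from l j))        ≡⟨ cong (to (h (from l j))) (coordinate-point _ (from l j)) ⟩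
      to (h (from l j)) (from (h (from l j)) (coordinate x (to l (from l j))))
                                                                ≡⟨ strictlyInverseˡ (h (from l j)) _ ⟩
      coordinate x (to l (from l j))                            ≡⟨ cong (coordinate x) (strictlyInverseˡ l j) ⟩
      coordinate x j                                            ∎)
    (λ x → coordinate-ext λ i → begin
      coordinate (back (there x)) i                             ≡⟨ coordinate-point _ i ⟩
      from (h i) (coordinate (there x) (to l i))                ≡⟨ cong (from (h i)) (there-coordinate x i) ⟩
      from (h i) (to (h i) (coordinate x i))                    ≡⟨ strictlyInverseʳ (h i) _ ⟩
      coordinate x i                                            ∎)
    where
    open ≡-Reasoning
    there back : A → A
    there x = point λ j → to (h (from l j)) (coordinate x (from l j))
    back x  = point λ i → from (h i) (coordinate x (to l i))
    there-coordinate : ∀ x i → coordinate (there x) (to l i) ≡ to (h i) (coordinate x i)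
    there-coordinate x i = trans (coordinate-point _ (to l i))
      (cong (λ j → to (h j) (coordinate x j)) (strictlyInverseʳ l i))

  assemble-acts : ∀ l h i → ActsAs (assemble l h) l i (h i)
  assemble-acts l h i x = trans (coordinate-point _ (to l i))
      (cong (λ j → to (h j) (coordinate x j)) (strictlyInverseʳ l i))

  -- Membership in a permuted tensor supplies `l` and, for each `i`, some element of `H` taking the
  -- `i`-th coordinates of `α` and `β` to the `to l i`-th coordinates of `γ` and `δ`. These
  -- unrelated choices are glued by `assemble`. Conversely, an element of the wreath product is read
  -- coordinate by coordinate.
  tensor-orbit : ∀ (t : Fin m → Relation (Carrier Γ)) α β →
    (∀ i γ δ → T (t i γ δ) ⇔ SameOrbit H (coordinate α i) (coordinate β i) γ δ) →
    ∀ γ δ → (Σ[ l ∈ Fin m ↔ Fin m ] l ∈ L.Mem × T (image (permuteCoordinates l) (⨂ t) (to f γ) (to f δ)))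
            ⇔ SameOrbit wreath α β γ δ
  tensor-orbit t α β orbit γ δ = mk⇔
    (λ (l , l∈ , p) →
      let h = λ i → Equivalence.to (orbit i _ _) (Equivalence.to (permuted-⨂⇔ l t (to f γ) (to f δ)) p i)
          g = assemble l (proj₁ ∘ h)
          maps : ∀ {x y} → (∀ i → to (proj₁ (h i)) (coordinate x i) ≡ coordinate y (to l i)) → to g x ≡ y
          maps {x} {y} eq = coordinate-ext λ j → trans
            (coordinate-point _ j) (trans (eq (from l j)) (cong (coordinate y) (strictlyInverseˡ l j)))
      in g , (l , l∈ , λ i → proj₁ (h i) , proj₁ (proj₂ (h i)) , assemble-acts l (proj₁ ∘ h) i) ,
         maps (proj₁ ∘ proj₂ ∘ proj₂ ∘ h) , maps (proj₂ ∘ proj₂ ∘ proj₂ ∘ h))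
    (λ { (g , (l , l∈ , acts) , refl , refl) → l , l∈ ,
      Equivalence.from (permuted-⨂⇔ l t (to f γ) (to f δ)) λ i → Equivalence.from (orbit i _ _)
        (let (h , h∈ , eq) = acts i in h , h∈ , sym (eq α) , sym (eq β)) })

  Inv-wreath : Isomorphic (Inv wreath) (Inv H ↑ L)
  Inv-wreath = f , λ t → mk⇔ (pull t) (λ (s , s∈ , t≐) → push t s s∈ t≐)
    where
    image-image : ∀ (t : Relation (Vec (Carrier Γ) m)) → t ≐ image f (image (↔-sym f) t)
    image-image t α β = sym (cong₂ t (strictlyInverseˡ f α) (strictlyInverseˡ f β))

    pull : ∀ t → t ∈ Rel (Inv H ↑ L) → Σ[ s ∈ Relation A ] s ∈ Rel (Inv wreath) × t ≐ image f s
    pull t (ts , ts∈ , union) = image (↔-sym f) t ,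
      (α , β , λ γ δ → mk⇔
        (Equivalence.to (same γ δ) ∘ Equivalence.to (union _ _))
        (Equivalence.from (union _ _) ∘ Equivalence.from (same γ δ))) , image-image t
      where
      -- Representatives of the orbitals `ts i`, put together coordinatewise, represent the whole
      -- relation.
      α β : A
      α = point (proj₁ ∘ ts∈)
      β = point (λ i → proj₁ (proj₂ (ts∈ i)))
      same : ∀ γ δ → _ ⇔ SameOrbit wreath α β γ δ
      same = tensor-orbit ts α β λ i γ δ → subst
        (λ (a , b) → T (ts i γ δ) ⇔ SameOrbit H a b γ δ)
        (cong₂ _,_ (sym (coordinate-point _ i)) (sym (coordinate-point _ i)))
        (proj₂ (proj₂ (ts∈ i)) γ δ)

    push : ∀ t s → s ∈ Rel (Inv wreath) → t ≐ image f s → t ∈ Rel (Inv H ↑ L)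
    push t s (α , β , orbit) t≐ = ts , ts∈ , λ x y → mk⇔
      (λ p → subst Tensor (cong₂ _,_ (strictlyInverseˡ f x) (strictlyInverseˡ f y))
        (Equivalence.from (same _ _) (Equivalence.to (orbit _ _) (subst T (t≐ x y) p))))
      (λ p → subst T (sym (t≐ x y)) (Equivalence.from (orbit _ _) (Equivalence.to (same _ _)
        (subst Tensor (sym (cong₂ _,_ (strictlyInverseˡ f x) (strictlyInverseˡ f y))) p))))
      where
      ts : Fin m → Relation (Carrier Γ)
      ts i = orbital Γ H (coordinate α i) (coordinate β i)
      ts∈ : ∀ i → ts i ∈ Rel (Inv H)
      ts∈ i = orbital∈ Γ H (coordinate α i) (coordinate β i)
      Tensor : Vec (Carrier Γ) m × Vec (Carrier Γ) m → Set
      Tensor (x , y) = Σ[ l ∈ Fin m ↔ Fin m ] l ∈ L.Mem × T (image (permuteCoordinates l) (⨂ ts) x y)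
      same : ∀ γ δ → _ ⇔ SameOrbit wreath α β γ δ
      same = tensor-orbit ts α β λ i → proj₂ (proj₂ (ts∈ i))

-- Orders of permutation groups

vec↔ : {A : Set} {n : ℕ} → A ↔ Fin n → ∀ d → Vec A d ↔ Fin (n ℕ.^ d)
vec↔ e zero    = mk↔ₛ′ (λ _ → zero) (λ _ → []) (λ { zero → refl }) (λ { [] → refl })
vec↔ e (suc d) = ↔-sym Fin.*↔× ↔-∘ ((e ×-↔ vec↔ e d) ↔-∘
  mk↔ₛ′ (λ v → head v , tail v) (λ (x , v) → x ∷ v) (λ _ → refl) (λ { (_ ∷ _) → refl }))

vecSet : FiniteSet → ℕ → FiniteSet
vecSet Ω d = record
  { Carrier = Vec (Carrier Ω) d
  ; size    = FiniteSet.size Ω ℕ.^ d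
  ; enum    = vec↔ (FiniteSet.enum Ω) d
  }

enumerate : ∀ {N} {P : Pred (Fin N) 0ℓ} → Decidable P → ∃ λ k → Σ[ e ∈ (Fin k → Fin N) ]
            (∀ i → P (e i)) × (∀ i j → e i ≡ e j → i ≡ j) × (∀ x → P x → ∃ λ i → e i ≡ x)
enumerate {zero}  P? = 0 , (λ ()) , (λ ()) , (λ ()) , (λ ())
enumerate {suc N} P? with enumerate (P? ∘ suc) | P? zero
... | k , e , e∈ , inj , onto | yes p = suc k , (λ { zero → zero ; (suc i) → suc (e i) }) ,
      (λ { zero → p ; (suc i) → e∈ i }) ,
      (λ { zero zero _ → refl ; (suc i) (suc j) eq → cong suc (inj i j (Fin.suc-injective eq)) }) ,
      (λ { zero _ → zero , refl ; (suc x) q → let (i , eq) = onto x q in suc i , cong suc eq })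
... | k , e , e∈ , inj , onto | no ¬p = k , suc ∘ e , e∈ , (λ i j → inj i j ∘ Fin.suc-injective) ,
      (λ { zero q → contradiction q ¬p ; (suc x) q → let (i , eq) = onto x q in i , cong suc eq })

module _ (Ω : FiniteSet) (G : PermGroup (Carrier Ω)) where
  open FiniteSet Ω using (_≟_; enum; size)
  private
    A = Carrier Ω
    codes = vecSet Ω size
    module C = FiniteSet codes

  Codes : Vec A size → A ↔ A → Set
  Codes v g = ∀ x → to g x ≡ lookup v (to enum x)

  -- Permutations are counted through their tables of values. The tables form a finite set with
  -- decidable equality, and a table determines a permutation up to `_≗ₚ_`, so each class is listed
  -- once.
  hasOrder : ∃ (HasOrder G)
  hasOrder with enumerate (λ i → anyPermutation Ω G {Codes (from C.enum i)}
                  (λ g≗h eq x → trans (sym (g≗h x)) (eq x)) (λ g → all? Ω λ x → to g x ≟ _))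
  ... | k , e , e∈ , inj , onto = k , proj₁ ∘ e∈ , proj₁ ∘ proj₂ ∘ e∈ ,
    (λ i j eq → inj i j (begin
      e i                           ≡⟨ strictlyInverseˡ C.enum (e i) ⟨
      to C.enum (from C.enum (e i)) ≡⟨ cong (to C.enum) (vec-ext (λ a → begin
        lookup (from C.enum (e i)) a                       ≡⟨ cong (lookup (from C.enum (e i))) (strictlyInverseˡ enum a) ⟨
        lookup (from C.enum (e i)) (to enum (from enum a)) ≡⟨ proj₂ (proj₂ (e∈ i)) (from enum a) ⟨
        to (proj₁ (e∈ i)) (from enum a)                    ≡⟨ eq (from enum a) ⟩
        to (proj₁ (e∈ j)) (from enum a)                    ≡⟨ proj₂ (proj₂ (e∈ j)) (from enum a) ⟩
        lookup (from C.enum (e j)) (to enum (from enum a)) ≡⟨ cong (lookup (from C.enum (e j))) (strictlyInverseˡ enum a) ⟩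
        lookup (from C.enum (e j)) a                       ∎)) ⟩
      to C.enum (from C.enum (e j)) ≡⟨ strictlyInverseˡ C.enum (e j) ⟩
      e j                           ∎)) ,
    λ g g∈ →
      let v = tabulate (to g ∘ from enum)
          read : ∀ x → lookup v (to enum x) ≡ to g x
          read x = trans (lookup∘tabulate _ (to enum x)) (cong (to g) (strictlyInverseʳ enum x))
          decode = strictlyInverseʳ C.enum v
          (i , eq) = onto (to C.enum v) (g , g∈ , λ x →
            trans (sym (read x)) (cong (λ w → lookup w (to enum x)) (sym decode)))
      in i , λ x → trans (proj₂ (proj₂ (e∈ i)) x)
           (trans (cong (λ w → lookup w (to enum x)) (trans (cong (from C.enum) eq) decode)) (read x))
    where open ≡-Reasoning

sum-ones : ∀ k → ℕSum.sum {k} (λ _ → 1) ≡ k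
sum-ones zero    = refl
sum-ones (suc k) = cong suc (sum-ones k)

sum-zeros : ∀ k → ℕSum.sum {k} (λ _ → 0) ≡ 0
sum-zeros zero    = refl
sum-zeros (suc k) = sum-zeros k

sum-indicator : ∀ {k} (c : Fin k) → ℕSum.sum (λ i → boolToℕ (does (i Fin.≟ c))) ≡ 1
sum-indicator {suc k} zero    = cong suc (sum-zeros k)
sum-indicator (suc c) = sum-indicator c

-- The points i < f i and the points f i < i are exchanged by f.
involution-odd : ∀ {k} (f : Fin k → Fin k) → (∀ i → f (f i) ≡ i) →
                 (c : Fin k) → f c ≡ c → (∀ i → f i ≡ i → i ≡ c) → ¬ (2 ∣ k)
involution-odd {k} f ff c fc unique 2∣k =
  contradiction (∣1⇒≡1 (∣m+n∣m⇒∣n (subst (2 ∣_) total 2∣k) (n∣m*n below))) λ ()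
  where
  open ≡-Reasoning
  lower upper fixed : Fin k → ℕ
  lower i = boolToℕ (does (i Fin.<? f i))
  upper i = boolToℕ (does (f i Fin.<? i))
  fixed i = boolToℕ (does (i Fin.≟ c))
  below = ℕSum.sum lower
  split : ∀ i → lower i ℕ.+ (upper i ℕ.+ fixed i) ≡ 1
  split i with Fin.<-cmp i (f i)
  ... | tri< p ¬q ¬r rewrite dec-true (i Fin.<? f i) p | dec-false (f i Fin.<? i) ¬r
                           | dec-false (i Fin.≟ c) (λ { refl → ¬q (sym fc) }) = refl
  ... | tri≈ ¬p q ¬r rewrite dec-false (i Fin.<? f i) ¬p | dec-false (f i Fin.<? i) ¬r
                           | dec-true (i Fin.≟ c) (unique i (sym q)) = refl
  ... | tri> ¬p ¬q r rewrite dec-false (i Fin.<? f i) ¬p | dec-true (f i Fin.<? i) r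
                           | dec-false (i Fin.≟ c) (λ { refl → ¬q (sym fc) }) = refl
  swapped : ℕSum.sum upper ≡ below
  swapped = begin
    ℕSum.sum upper       ≡⟨ ℕSum.sum-permute upper (mk↔ₛ′ f f ff ff) ⟩
    ℕSum.sum (upper ∘ f) ≡⟨ ℕSum.sum-cong-≗ (λ i → cong (λ j → boolToℕ (does (j Fin.<? f i))) (ff i)) ⟩
    below          ∎
  total : k ≡ below ℕ.* 2 ℕ.+ 1
  total = begin
    k                                              ≡⟨ sum-ones k ⟨
    ℕSum.sum {k} (λ _ → 1)                               ≡⟨ ℕSum.sum-cong-≗ split ⟨
    ℕSum.sum (λ i → lower i ℕ.+ (upper i ℕ.+ fixed i))       ≡⟨ ℕSum.∑-distrib-+ lower _ ⟩
    below ℕ.+ ℕSum.sum (λ i → upper i ℕ.+ fixed i)           ≡⟨ cong (below ℕ.+_) (ℕSum.∑-distrib-+ upper fixed) ⟩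
    below ℕ.+ (ℕSum.sum upper ℕ.+ ℕSum.sum fixed)                  ≡⟨ cong₂ (λ a b → below ℕ.+ (a ℕ.+ b)) swapped (sum-indicator c) ⟩
    below ℕ.+ (below ℕ.+ 1)                            ≡⟨ ℕ.+-assoc below below 1 ⟨
    below ℕ.+ below ℕ.+ 1                              ≡⟨ cong (λ b → below ℕ.+ b ℕ.+ 1) (ℕ.+-identityʳ below) ⟨
    2 ℕ.* below ℕ.+ 1                                  ≡⟨ cong (ℕ._+ 1) (ℕ.*-comm 2 below) ⟩
    below ℕ.* 2 ℕ.+ 1                                  ∎

-- Inversion is an involution on the list of elements, and its fixed points are the elements of
-- square one. By hypothesis the identity is the only one, so `involution-odd` applies.
noInvolution⇒oddOrder : (Ω : FiniteSet) (G : PermGroup (Carrier Ω)) →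
  (∀ g → g ∈ Mem G → (∀ x → to g (to g x) ≡ x) → ∀ x → to g x ≡ x) → OddOrder G
noInvolution⇒oddOrder Ω G noInvolution with hasOrder Ω G
... | k , e , e∈ , inj , onto = k , (e , e∈ , inj , onto) ,
  involution-odd inv
    (λ i → inj _ _ λ x → begin
      to (e (inv (inv i))) x          ≡⟨ inv-≗ (inv i) x ⟩
      from (e (inv i)) x              ≡⟨ from-inv i x ⟩
      to (e i) x                      ∎)
    c (inj _ _ λ x → begin
      to (e (inv c)) x   ≡⟨ inv-≗ c x ⟩
      from (e c) x       ≡⟨ cong (from (e c)) (c-id x) ⟨
      from (e c) (to (e c) x) ≡⟨ strictlyInverseʳ (e c) x ⟩
      x                  ≡⟨ c-id x ⟨
      to (e c) x         ∎)
    λ i eq → inj i c λ x → trans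
      (noInvolution (e i) (e∈ i) (λ y → begin
        to (e i) (to (e i) y)         ≡⟨ cong (λ j → to (e i) (to (e j) y)) eq ⟨
        to (e i) (to (e (inv i)) y)   ≡⟨ cancel i y ⟩
        y                             ∎) x)
      (sym (c-id x))
  where
  open ≡-Reasoning
  inv : Fin k → Fin k
  inv i = proj₁ (onto (↔-sym (e i)) (PermGroup.inv∈ G (e∈ i)))
  inv-≗ : ∀ i x → to (e (inv i)) x ≡ from (e i) x
  inv-≗ i = proj₂ (onto (↔-sym (e i)) (PermGroup.inv∈ G (e∈ i)))
  cancel : ∀ i x → to (e i) (to (e (inv i)) x) ≡ x
  cancel i x = trans (cong (to (e i)) (inv-≗ i x)) (strictlyInverseˡ (e i) x)
  from-inv : ∀ i x → from (e (inv i)) x ≡ to (e i) x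
  from-inv i x = begin
    from (e (inv i)) x  ≡⟨ cong (from (e (inv i))) (strictlyInverseʳ (e i) x) ⟨
    from (e (inv i)) (from (e i) (to (e i) x)) ≡⟨ cong (from (e (inv i))) (inv-≗ i _) ⟨
    from (e (inv i)) (to (e (inv i)) (to (e i) x)) ≡⟨ strictlyInverseʳ (e (inv i)) _ ⟩
    to (e i) x ∎
  c : Fin k
  c = proj₁ (onto (↔-id _) (PermGroup.id∈ G))
  c-id : ∀ x → to (e c) x ≡ x
  c-id = proj₂ (onto (↔-id _) (PermGroup.id∈ G))

-- Affine structure of primitive solvable groups

productSet : FiniteSet → FiniteSet → FiniteSet
productSet Ω Δ = record
  { Carrier = Carrier Ω × Carrier Δ
  ; size    = FiniteSet.size Ω ℕ.* FiniteSet.size Δ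
  ; enum    = ↔-sym Fin.*↔× ↔-∘ (FiniteSet.enum Ω ×-↔ FiniteSet.enum Δ)
  }

-- Double negation commutes with finite conjunctions. This allows membership in an orbit to be
-- assumed decidable at all points simultaneously.
¬¬-finite : (Ω : FiniteSet) {P : Pred (Carrier Ω) 0ℓ} → (∀ x → ¬ ¬ P x) → ¬ ¬ (∀ x → P x)
¬¬-finite Ω {P} ¬¬P ¬all = go (¬¬P ∘ from enum) λ all → ¬all λ x →
  subst P (strictlyInverseʳ enum x) (all (to enum x))
  where
  open FiniteSet Ω using (enum)
  go : ∀ {n} {Q : Pred (Fin n) 0ℓ} → (∀ i → ¬ ¬ Q i) → ¬ ¬ (∀ i → Q i)
  go {zero}  _   ¬all = ¬all λ ()
  go {suc n} ¬¬Q ¬all = ¬¬Q zero λ q → go (¬¬Q ∘ suc) λ qs →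
    ¬all λ { zero → q ; (suc i) → qs i }

conjugate : {A : Set} → A ↔ A → A ↔ A → A ↔ A
conjugate g n = g ↔-∘ (n ↔-∘ ↔-sym g)

module _ {A : Set} where

  Derived-conjugate : {H : Pred (A ↔ A) 0ℓ} (g : A ↔ A) → (∀ {n} → n ∈ H → conjugate g n ∈ H) →
                      ∀ {n} → n ∈ Derived H → conjugate g n ∈ Derived H
  Derived-conjugate {H} g closed = go
    where
    cancel : ∀ x → from g (to g x) ≡ x
    cancel = strictlyInverseʳ g
    go : ∀ {n} → n ∈ Derived H → conjugate g n ∈ Derived H
    -- The conjugate of a commutator agrees with the commutator of the conjugates only pointwise,
    -- after the inner pairs `from g (to g x)` cancel.
    go (commutator {a} {b} a∈ b∈) = respects
      (λ x → cong (to g) (trans (cong (from a) (cancel _)) (cong (from a ∘ from b)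
        (trans (cancel _) (cong (to a) (cancel _))))))
      (commutator (closed a∈) (closed b∈))
    go identity = respects (λ x → sym (strictlyInverseˡ g x)) identity
    go (product {a} {b} a∈ b∈) = respects (λ x → cong (to g ∘ to a) (cancel _)) (product (go a∈) (go b∈))
    go (inverse a∈) = respects (λ x → refl) (inverse (go a∈))
    go (respects a≗b a∈) = respects (λ x → cong (to g) (a≗b (from g x))) (go a∈)

  record NormalAbelian (G : PermGroup A) (N : Pred (A ↔ A) 0ℓ) : Set where
    field
      ⊆G    : N ⊆ Mem G
      id∈   : ↔-id A ∈ N
      ∘∈    : ∀ {m n} → m ∈ N → n ∈ N → m ↔-∘ n ∈ N
      inv∈  : ∀ {n} → n ∈ N → ↔-sym n ∈ N
      conj∈ : ∀ {g n} → g ∈ Mem G → n ∈ N → conjugate g n ∈ N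
      comm  : ∀ {m n} → m ∈ N → n ∈ N → ∀ x → to m (to n x) ≡ to n (to m x)

  module _ (G : PermGroup A) where
    private module G = PermGroup G

    Trivial : Pred (A ↔ A) 0ℓ → Set
    Trivial N = ∀ n → n ∈ N → n ≗ₚ ↔-id A

    derived-⊆ : ∀ k → derivedSeries G k ⊆ Mem G
    derived-⊆ zero    = id
    derived-⊆ (suc k) = go
      where
      go : Derived (derivedSeries G k) ⊆ Mem G
      go (commutator a∈ b∈) = G.∘∈ (G.inv∈ (derived-⊆ k a∈)) (G.∘∈ (G.inv∈ (derived-⊆ k b∈))
        (G.∘∈ (derived-⊆ k a∈) (derived-⊆ k b∈)))
      go identity           = G.id∈
      go (product a∈ b∈)    = G.∘∈ (go a∈) (go b∈)
      go (inverse a∈)       = G.inv∈ (go a∈)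
      go (respects a≗b a∈)  = G.resp a≗b (go a∈)

    derived-conj : ∀ k {g} → g ∈ Mem G → ∀ {n} → n ∈ derivedSeries G k → conjugate g n ∈ derivedSeries G k
    derived-conj zero    g∈ n∈ = G.∘∈ g∈ (G.∘∈ n∈ (G.inv∈ g∈))
    derived-conj (suc k) {g} g∈ = Derived-conjugate g (derived-conj k g∈)

    -- Two elements commute as soon as their commutator, which lies in the next term, is trivial.
    derived-normalAbelian : ∀ k → Trivial (derivedSeries G (suc k)) → NormalAbelian G (derivedSeries G k)
    derived-normalAbelian k trivial = record
      { ⊆G    = derived-⊆ k
      ; id∈   = id∈ k
      ; ∘∈    = ∘∈ k
      ; inv∈  = inv∈ k
      ; conj∈ = λ g∈ n∈ → derived-conj k g∈ n∈
      ; comm  = λ {m} {n} m∈ n∈ x → begin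
          to m (to n x)                                            ≡⟨ strictlyInverseˡ n _ ⟨
          to n (from n (to m (to n x)))                            ≡⟨ cong (to n) (strictlyInverseˡ m _) ⟨
          to n (to m (from m (from n (to m (to n x)))))            ≡⟨ cong (to n ∘ to m) (trivial _ (commutator m∈ n∈) x) ⟩
          to n (to m x)                                            ∎
      }
      where
      open ≡-Reasoning
      id∈ : ∀ k → ↔-id A ∈ derivedSeries G k
      id∈ zero    = G.id∈
      id∈ (suc k) = identity
      ∘∈ : ∀ k {m n} → m ∈ derivedSeries G k → n ∈ derivedSeries G k → m ↔-∘ n ∈ derivedSeries G k
      ∘∈ zero    = G.∘∈
      ∘∈ (suc k) = product
      inv∈ : ∀ k {n} → n ∈ derivedSeries G k → ↔-sym n ∈ derivedSeries G k
      inv∈ zero    = G.inv∈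
      inv∈ (suc k) = inverse

    -- Descends from a trivial term of the derived series to the first term that is not trivial.
    -- Each step asks whether a term is trivial, which is answered by excluded middle under double
    -- negation.
    ¬¬-normalAbelian : ¬ Trivial (Mem G) → Solvable G →
                       ¬ ¬ (Σ[ N ∈ Pred (A ↔ A) 0ℓ ] NormalAbelian G N × ¬ Trivial N)
    ¬¬-normalAbelian nontrivial (k , trivial) = go k trivial
      where
      go : ∀ k → Trivial (derivedSeries G k) →
           ¬ ¬ (Σ[ N ∈ Pred (A ↔ A) 0ℓ ] NormalAbelian G N × ¬ Trivial N)
      go zero    trivial none = nontrivial trivial
      go (suc k) trivial none = ¬¬-excluded-middle λ
        { (yes trivial′) → go k trivial′ none
        ; (no ¬trivial)  → none (derivedSeries G k , derived-normalAbelian k trivial , ¬trivial) }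

  -- The group structure carried over from a regular abelian normal subgroup to the points.
  record IsTranslationTable (G : PermGroup A) (o : A) (_+_ : A → A → A) : Set where
    field
      translation : ∀ a → Σ[ g ∈ A ↔ A ] g ∈ Mem G × (∀ x → to g x ≡ a + x)
      identityʳ   : ∀ a → a + o ≡ a
      comm        : ∀ a b → a + b ≡ b + a
      assoc       : ∀ a b c → (a + b) + c ≡ a + (b + c)
      inverseʳ    : ∀ a → ∃ λ b → a + b ≡ o
      linear      : ∀ g → g ∈ Mem G → to g o ≡ o → ∀ a b → to g (a + b) ≡ to g a + to g b

module _ (Ω : FiniteSet) (G : PermGroup (Carrier Ω)) where
  open FiniteSet Ω using (_≟_)
  private
    A = Carrier Ω
    module G = PermGroup G

  module _ {N : Pred (A ↔ A) 0ℓ} (normal : NormalAbelian G N) where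
    private module N = NormalAbelian normal

    Reaches : A → A → Set
    Reaches α β = Σ[ n ∈ A ↔ A ] n ∈ N × to n α ≡ β

    -- By normality `g` maps orbits of `N` to orbits of `N`, so the orbit of `α` is either preserved
    -- or moved off itself, according to whether it contains `to g α`.
    orbit-block : ∀ α (reaches? : ∀ β → Dec (Reaches α β)) → IsBlock G (does ∘ reaches?)
    orbit-block α reaches? = (α , ∈orbit (↔-id A , N.id∈ , refl)) , λ g g∈ → decide g g∈
      where
      ∈orbit : ∀ {β} → Reaches α β → T (does (reaches? β))
      ∈orbit {β} = Equivalence.from (T-does (reaches? β))
      orbit∈ : ∀ {β} → T (does (reaches? β)) → Reaches α β
      orbit∈ {β} = Equivalence.to (T-does (reaches? β))

      step : ∀ {β γ} → Reaches α β → Reaches β γ → Reaches α γ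
      step (m , m∈ , refl) (n , n∈ , refl) = n ↔-∘ m , N.∘∈ n∈ m∈ , refl
      back : ∀ {β γ} → Reaches β γ → Reaches γ β
      back (n , n∈ , refl) = ↔-sym n , N.inv∈ n∈ , strictlyInverseʳ n _
      move : ∀ {g} → g ∈ Mem G → ∀ {β γ} → Reaches β γ → Reaches (to g β) (to g γ)
      move {g} g∈ (n , n∈ , refl) =
        conjugate g n , N.conj∈ g∈ n∈ , cong (to g ∘ to n) (strictlyInverseʳ g _)

      decide : ∀ g → g ∈ Mem G →
        (∀ β → T (does (reaches? β)) ⇔ T (does (reaches? (to g β)))) ⊎
        (∀ β → T (does (reaches? β)) → ¬ T (does (reaches? (to g β))))
      decide g g∈ with reaches? (to g α)
      ... | yes r = inj₁ λ β → mk⇔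
        (λ t → ∈orbit (step r (move g∈ (orbit∈ t))))
        (λ t → ∈orbit (subst (Reaches α) (strictlyInverseʳ g β)
          (step {from g α} (back (subst (Reaches (from g α)) (strictlyInverseʳ g α) (move (G.inv∈ g∈) r)))
            (move (G.inv∈ g∈) (orbit∈ t)))))
      ... | no ¬r = inj₂ λ β t t′ → ¬r (step (orbit∈ t′) (move g∈ (back (orbit∈ t))))

    -- A transitive abelian group is regular: its elements are determined by the image of `o`.
    -- Identifying the element that takes `o` to `a` with `a` itself makes the composition in `N` an
    -- addition of points.
    regular-table : ∀ {o} → (∀ β → Reaches o β) → ∃ (IsTranslationTable G o)
    regular-table {o} reach = _+_ , record
      { translation = λ a → elem a , N.⊆G (elem∈ a) , λ x → refl
      ; identityʳ   = elem-o
      ; comm        = λ a b → trans (cong (to (elem a)) (sym (elem-o b)))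
                        (trans (N.comm (elem∈ a) (elem∈ b) o) (cong (to (elem b)) (elem-o a)))
      ; assoc       = λ a b → regular (elem∈ (a + b)) (N.∘∈ (elem∈ a) (elem∈ b))
                        (trans (elem-o (a + b)) (cong (to (elem a)) (sym (elem-o b))))
      ; inverseʳ    = λ a → from (elem a) o , strictlyInverseˡ (elem a) o
      -- If `g` fixes `o`, conjugation by `g` turns the element of `N` taking `o` to `a` into one
      -- taking `o` to `to g a`, and regularity identifies it with `elem (to g a)`.
      ; linear      = λ g g∈ go a b → trans (cong (to g ∘ to (elem a)) (sym (strictlyInverseʳ g b)))
          (regular (N.conj∈ g∈ (elem∈ a)) (elem∈ (to g a))
            (trans (cong (to g ∘ to (elem a)) (trans (cong (from g) (sym go)) (strictlyInverseʳ g o)))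
              (trans (cong (to g) (elem-o a)) (sym (elem-o (to g a))))) (to g b))
      }
      where
      elem : A → A ↔ A
      elem a = proj₁ (reach a)
      elem∈ : ∀ a → elem a ∈ N
      elem∈ a = proj₁ (proj₂ (reach a))
      elem-o : ∀ a → to (elem a) o ≡ a
      elem-o a = proj₂ (proj₂ (reach a))
      _+_ : A → A → A
      a + b = to (elem a) b
      regular : ∀ {m n} → m ∈ N → n ∈ N → to m o ≡ to n o → ∀ x → to m x ≡ to n x
      regular {m} {n} m∈ n∈ eq x = begin
        to m x               ≡⟨ cong (to m) (elem-o x) ⟨
        to m (to (elem x) o) ≡⟨ N.comm m∈ (elem∈ x) o ⟩
        to (elem x) (to m o) ≡⟨ cong (to (elem x)) eq ⟩
        to (elem x) (to n o) ≡⟨ N.comm n∈ (elem∈ x) o ⟨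
        to n (to (elem x) o) ≡⟨ cong (to n) (elem-o x) ⟩
        to n x               ∎
        where open ≡-Reasoning

  opaque
    translationTable? : Dec (∃₂ (IsTranslationTable G))
    translationTable? = searchCarrier Ω λ o → map′
      (λ (f , t) → curry f , t) (λ (f , t) → uncurry f , t)
      (searchMaps (productSet Ω Ω) (searchCarrier Ω) (resp o) (λ f → table? o (curry f)))
      where
      resp : ∀ o {f g : A × A → A} → f ≗ g → IsTranslationTable G o (curry f) → IsTranslationTable G o (curry g)
      resp o {f} {g} f≗g table = record
        { translation = λ a → let (h , h∈ , eq) = translation a in h , h∈ , λ x → trans (eq x) (f≗g _)
        ; identityʳ   = λ a → trans (sym (f≗g _)) (identityʳ a)
        ; comm        = λ a b → trans (sym (f≗g _)) (trans (comm a b) (f≗g _))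
        ; assoc       = λ a b c → trans (sym (trans (f≗g _) (cong (λ y → g (y , c)) (f≗g _))))
            (trans (assoc a b c) (trans (f≗g _) (cong (λ y → g (a , y)) (f≗g _))))
        ; inverseʳ    = λ a → let (b , eq) = inverseʳ a in b , trans (sym (f≗g _)) eq
        ; linear      = λ h h∈ ho a b → trans (cong (to h) (sym (f≗g _))) (trans (linear h h∈ ho a b) (f≗g _))
        }
        where open IsTranslationTable table
      table? : ∀ o _+_ → Dec (IsTranslationTable G o _+_)
      table? o _+_ = map′
        (λ (p , q , r , s , t , u) → record
          { translation = p ; identityʳ = q ; comm = r ; assoc = s ; inverseʳ = t ; linear = u })
        (λ t → let open IsTranslationTable t in translation , identityʳ , comm , assoc , inverseʳ , linear)
        ( all? Ω (λ a → anyPermutation Ω G (λ g≗h eq x → trans (sym (g≗h x)) (eq x))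
                          λ g → all? Ω λ x → to g x ≟ (a + x))
        ×-dec all? Ω (λ a → (a + o) ≟ a)
        ×-dec all? Ω (λ a → all? Ω λ b → (a + b) ≟ (b + a))
        ×-dec all? Ω (λ a → all? Ω λ b → all? Ω λ c → ((a + b) + c) ≟ (a + (b + c)))
        ×-dec all? Ω (λ a → searchCarrier Ω λ b → (a + b) ≟ o)
        ×-dec allPermutations Ω G
          (λ g≗h lin ho a b → trans (sym (g≗h _)) (trans (lin (trans (g≗h o) ho) a b)
            (cong₂ _+_ (g≗h a) (g≗h b))))
          λ g → (to g o ≟ o) →-dec all? Ω λ a → all? Ω λ b → to g (a + b) ≟ (to g a + to g b))

  -- Existence of a table is decidable, so the minimal normal subgroup may be found classically.
  translationTable : Primitive G → Solvable G → ∃₂ (IsTranslationTable G)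
  translationTable prim solv = decidable-stable translationTable? λ none →
    ¬¬-normalAbelian G nontrivial′ solv λ (N , normal , nontrivialN) →
    nontrivialN λ n n∈ α → decidable-stable (to n α ≟ α) λ nα≢α →
    ¬¬-finite Ω (λ β → ¬¬-excluded-middle {A = Reaches normal α β}) λ reaches? →
    none (α , regular-table normal (transitiveN normal α reaches? n n∈ nα≢α))
    where
    open Primitive prim
    nontrivial′ : ¬ Trivial G (Mem G)
    nontrivial′ trivial = let (α , β , α≢β) = nontrivial
                              (g , g∈ , gα) = transitive α β
                          in α≢β (trans (sym (trivial g g∈ α)) gα)
    transitiveN : ∀ {N} (normal : NormalAbelian G N) α (reaches? : ∀ β → Dec (Reaches normal α β)) →
                  ∀ n → n ∈ N → to n α ≢ α → ∀ β → Reaches normal α β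
    transitiveN normal α reaches? n n∈ nα≢α β
      with blocks (does ∘ reaches?) (orbit-block normal α reaches?)
    ... | inj₂ all = Equivalence.to (T-does (reaches? β)) (all β)
    ... | inj₁ one = contradiction
      (one _ _ (Equivalence.from (T-does (reaches? (to n α))) (n , n∈ , refl))
               (Equivalence.from (T-does (reaches? α)) (↔-id A , NormalAbelian.id∈ normal , refl))) nα≢α

largest : {P : Pred ℕ 0ℓ} → Decidable P → ∀ n → (∀ t → P t → t ≤ n) → ∃ P →
          ∃ λ t → P t × (∀ s → t < s → ¬ P s)
largest P? zero bound (k , Pk) with refl ← ℕ.n≤0⇒n≡0 (bound k Pk) =
  0 , Pk , λ s 0<s Ps → ℕ.<⇒≱ 0<s (bound s Ps)
largest P? (suc n) bound ∃P with P? (suc n)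
... | yes p = suc n , p , λ s n<s Ps → ℕ.<⇒≱ n<s (bound s Ps)
... | no ¬p = largest P? n (λ t Pt → ℕ.s≤s⁻¹ (ℕ.≤∧≢⇒< (bound t Pt) λ { refl → ¬p Pt })) ∃P

parity : ∀ n → ∃ λ m → n ≡ m ℕ.+ m ⊎ n ≡ suc (m ℕ.+ m)
parity zero = 0 , inj₁ refl
parity (suc n) with parity n
... | m , inj₁ refl = m , inj₂ refl
... | m , inj₂ refl = suc m , inj₁ (cong suc (sym (ℕ.+-suc m m)))

-- The group of points, its stabilizer and its prime exponent

module Affine (Ω : FiniteSet) (G : PermGroup (Carrier Ω)) (o : Carrier Ω)
              (plus : Carrier Ω → Carrier Ω → Carrier Ω) (table : IsTranslationTable G o plus) where
  open FiniteSet Ω using (_≟_; enum; size) public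
  open IsTranslationTable table public using (translation; linear)
  private module Table = IsTranslationTable table

  A : Set
  A = Carrier Ω

  module G = PermGroup G

  infixl 6 _+_
  infix 8 -_

  _+_ : A → A → A
  _+_ = plus

  -_ : A → A
  - a = proj₁ (Table.inverseʳ a)

  abelianGroup : AbelianGroup 0ℓ 0ℓ
  abelianGroup = record
    { Carrier = A ; _≈_ = _≡_ ; _∙_ = _+_ ; ε = o ; _⁻¹ = -_
    ; isAbelianGroup = record
      { isGroup = record
        { isMonoid = record
          { isSemigroup = record
            { isMagma = record { isEquivalence = isEquivalence ; ∙-cong = cong₂ _+_ }
            ; assoc   = Table.assoc }
          ; identity = (λ a → trans (Table.comm o a) (Table.identityʳ a)) , Table.identityʳ }
        ; inverse = (λ a → trans (Table.comm _ a) (proj₂ (Table.inverseʳ a))) , (λ a → proj₂ (Table.inverseʳ a))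
        ; ⁻¹-cong = cong -_ }
      ; comm = Table.comm } }

  open AbelianGroup abelianGroup public
    using (identityˡ; identityʳ; inverseˡ; inverseʳ; assoc; comm; commutativeMonoid)
  open AbelianGroupProperties abelianGroup public
    using (∙-cancelˡ; inverseˡ-unique; inverseʳ-unique; x∙y⁻¹≈ε⇒x≈y)
  open CommutativeSemigroupProperties (AbelianGroup.commutativeSemigroup abelianGroup) public using (interchange)
  open Mult commutativeMonoid public
    using (×-homo-+; ×-assocˡ; ×-distrib-+) renaming (_×_ to _•_)
  open FiniteSum commutativeMonoid public using (sum; sum-cong-≗; ∑-distrib-+)

  Stab : Pred (A ↔ A) 0ℓ
  Stab = Stabilizer (Mem G) o

  stab-∘ : ∀ {g h} → g ∈ Stab → h ∈ Stab → g ↔-∘ h ∈ Stab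
  stab-∘ {g} (g∈ , go) (h∈ , ho) = G.∘∈ g∈ h∈ , trans (cong (to g) ho) go

  stab-inv : ∀ {g} → g ∈ Stab → ↔-sym g ∈ Stab
  stab-inv {g} (g∈ , go) = G.inv∈ g∈ , trans (cong (from g) (sym go)) (strictlyInverseʳ g o)

  Additive : (A → A) → Set
  Additive f = ∀ x y → f (x + y) ≡ f x + f y

  stab-additive : ∀ {g} → g ∈ Stab → Additive (to g)
  stab-additive {g} (g∈ , go) = linear g g∈ go

  module _ {f : A → A} (f-+ : Additive f) where

    additive-o : f o ≡ o
    additive-o = ∙-cancelˡ (f o) _ _ (begin
      f o + f o ≡⟨ f-+ o o ⟨
      f (o + o) ≡⟨ cong f (identityˡ o) ⟩
      f o       ≡⟨ identityʳ (f o) ⟨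
      f o + o   ∎)
      where open ≡-Reasoning

    additive-neg : ∀ x → f (- x) ≡ - f x
    additive-neg x = inverseʳ-unique (f x) (f (- x))
      (trans (sym (f-+ x (- x))) (trans (cong f (inverseʳ x)) additive-o))

    additive-• : ∀ n x → f (n • x) ≡ n • f x
    additive-• zero    x = additive-o
    additive-• (suc n) x = trans (f-+ x (n • x)) (cong (f x +_) (additive-• n x))

    additive-sum : ∀ {n} (w : Fin n → A) → f (sum w) ≡ sum (f ∘ w)
    additive-sum {zero}  w = additive-o
    additive-sum {suc n} w = trans (f-+ (w zero) _) (cong (f (w zero) +_) (additive-sum (w ∘ suc)))

  opaque
    -- Following `g` by the translation by `- to g o` returns `o` to itself.
    linearPart : ∀ {g} → g ∈ Mem G → Σ[ κ ∈ A ↔ A ] κ ∈ Stab × (∀ x → to g x ≡ to κ x + to g o)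
    linearPart {g} g∈ with h , h∈ , eq ← translation (- to g o) = h ↔-∘ g ,
      (G.∘∈ h∈ g∈ , trans (eq _) (inverseˡ (to g o))) , λ x → begin
        to g x                          ≡⟨ identityˡ _ ⟨
        o + to g x                      ≡⟨ cong (_+ to g x) (inverseʳ (to g o)) ⟨
        to g o + (- to g o) + to g x    ≡⟨ assoc _ _ _ ⟩
        to g o + ((- to g o) + to g x)  ≡⟨ comm _ _ ⟩
        (- to g o) + to g x + to g o    ≡⟨ cong (_+ to g o) (eq (to g x)) ⟨
        to h (to g x) + to g o          ∎
        where open ≡-Reasoning

  sum-zero : ∀ {n} (w : Fin n → A) → (∀ i → w i ≡ o) → sum w ≡ o
  sum-zero {zero}  w w≡o = refl
  sum-zero {suc n} w w≡o = trans (cong₂ _+_ (w≡o zero) (sum-zero (w ∘ suc) (w≡o ∘ suc))) (identityˡ o)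

  sum-single : ∀ {n} (w : Fin n → A) j → (∀ i → i ≢ j → w i ≡ o) → sum w ≡ w j
  sum-single w zero    w≡o = trans (cong (w zero +_) (sum-zero (w ∘ suc) λ i → w≡o (suc i) λ ())) (identityʳ _)
  sum-single w (suc j) w≡o = trans (cong (_+ sum (w ∘ suc)) (w≡o zero λ ()))
    (trans (identityˡ _) (sum-single (w ∘ suc) j λ i i≢j → w≡o (suc i) (i≢j ∘ Fin.suc-injective)))

  opaque
    -- Two of the `size + 1` multiples of `α` by `0, ..., size` coincide, and the difference of
    -- their indices is positive.
    positive-multiple : ∀ α → ∃ λ n → suc n • α ≡ o
    positive-multiple α
      with i , j , i<j , eq ← Fin.pigeonhole (ℕ.n<1+n size) (λ i → to enum (toℕ i • α))
      with k , j≡ ← ℕ.m≤n⇒∃[o]m+o≡n i<j = k , sym (∙-cancelˡ (toℕ i • α) _ _ (begin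
        toℕ i • α + o          ≡⟨ identityʳ _ ⟩
        toℕ i • α              ≡⟨ trans (sym (strictlyInverseʳ enum _))
                                    (trans (cong (from enum) eq) (strictlyInverseʳ enum _)) ⟩
        toℕ j • α              ≡⟨ cong (_• α) (trans (sym j≡) (sym (ℕ.+-suc (toℕ i) k))) ⟩
        (toℕ i ℕ.+ suc k) • α  ≡⟨ ×-homo-+ α (toℕ i) (suc k) ⟩
        toℕ i • α + suc k • α  ∎))
        where open ≡-Reasoning

  opaque
    -- The prime factors of an annihilating multiple are removed one at a time. The first removal
    -- that leaves a nonzero point exhibits a point killed by that prime; it must occur, since
    -- removing all the factors leaves `α`.
    prime-torsion : ∀ {α} → α ≢ o → ∃₂ λ p β → Prime p × β ≢ o × p • β ≡ o
    prime-torsion {α} α≢o with n , nα ← positive-multiple α =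
      go (PrimeFactorisation.factors F) (PrimeFactorisation.factorsPrime F)
        (trans (cong (_• α) (sym (PrimeFactorisation.isFactorisation F))) nα)
      where
      F : PrimeFactorisation (suc n)
      F = factorise (suc n)
      go : ∀ ps → All Prime ps → ∏ ps • α ≡ o → ∃₂ λ p β → Prime p × β ≢ o × p • β ≡ o
      go []       []             eq = contradiction (trans (sym (identityʳ α)) eq) α≢o
      go (p ∷ ps) (p-prime ∷ rest) eq with (∏ ps • α) ≟ o
      ... | yes eq′ = go ps rest eq′
      ... | no  neq = p , ∏ ps • α , p-prime , neq , trans (×-assocˡ α p (∏ ps)) eq

  power : A ↔ A → ℕ → A ↔ A
  power g zero    = ↔-id A
  power g (suc n) = g ↔-∘ power g n

  power-∈ : ∀ {g} → g ∈ Mem G → ∀ n → power g n ∈ Mem G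
  power-∈ g∈ zero    = G.id∈
  power-∈ g∈ (suc n) = G.∘∈ g∈ (power-∈ g∈ n)

  power-+ : ∀ g m n x → to (power g (m ℕ.+ n)) x ≡ to (power g m) (to (power g n) x)
  power-+ g zero    n x = refl
  power-+ g (suc m) n x = cong (to g) (power-+ g m n x)

  period : ∀ g x → ∃ λ n → to (power g (suc n)) x ≡ x
  period g x
    with i , j , i<j , eq ← Fin.pigeonhole (ℕ.n<1+n size) (λ i → to enum (to (power g (toℕ i)) x))
    with n , j≡ ← ℕ.m≤n⇒∃[o]m+o≡n i<j = n , (begin
      to (power g (suc n)) x  ≡⟨ strictlyInverseʳ gⁱ _ ⟨
      from gⁱ (to gⁱ (to (power g (suc n)) x))  ≡⟨ cong (from gⁱ) (power-+ g (toℕ i) (suc n) x) ⟨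
      from gⁱ (to (power g (toℕ i ℕ.+ suc n)) x)  ≡⟨ cong (λ m → from gⁱ (to (power g m) x)) (trans (ℕ.+-suc (toℕ i) n) j≡) ⟩
      from gⁱ (to (power g (toℕ j)) x)  ≡⟨ cong (from gⁱ) (trans (sym (strictlyInverseʳ enum _))
                                               (trans (cong (from enum) eq) (strictlyInverseʳ enum _))) ⟨
      from gⁱ (to gⁱ x)  ≡⟨ strictlyInverseʳ gⁱ x ⟩
      x  ∎)
    where
    open ≡-Reasoning
    gⁱ : A ↔ A
    gⁱ = power g (toℕ i)

  -- An invariant subgroup is a block of G.
  opaque
    invariant-subgroup : Primitive G → (B : A → Bool) → T (B o) →
      (∀ {x y} → T (B x) → T (B y) → T (B (x + y))) → (∀ {x} → T (B x) → T (B (- x))) →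
      (∀ {κ} → κ ∈ Stab → ∀ {x} → T (B x) → T (B (to κ x))) →
      (∀ x → T (B x) → x ≡ o) ⊎ (∀ x → T (B x))
    invariant-subgroup prim B o∈ +∈ -∈ κ∈ =
      Sum.map (λ one x t → one x o t o∈) id (Primitive.blocks prim B ((o , o∈) , block))
      where
      plus-neg : ∀ x y → x + y + (- y) ≡ x
      plus-neg x y = trans (assoc x y (- y)) (trans (cong (x +_) (inverseʳ y)) (identityʳ x))
      block : ∀ g → g ∈ Mem G →
        (∀ x → T (B x) ⇔ T (B (to g x))) ⊎ (∀ x → T (B x) → ¬ T (B (to g x)))
      block g g∈ with κ , κ∈K , eq ← linearPart g∈ | T? (B (to g o))
      ... | yes b∈ = inj₁ λ x → mk⇔
        (λ t → subst (T ∘ B) (sym (eq x)) (+∈ (κ∈ κ∈K t) b∈))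
        (λ t → subst (T ∘ B) (strictlyInverseʳ κ x) (κ∈ (stab-inv κ∈K)
          (subst (T ∘ B) (trans (cong (_+ (- to g o)) (eq x)) (plus-neg _ _)) (+∈ t (-∈ b∈)))))
      ... | no b∉ = inj₂ λ x t t′ → b∉ (subst (T ∘ B)
        (trans (cong (_+ (- to κ x)) (trans (eq x) (comm _ _))) (plus-neg _ _)) (+∈ t′ (-∈ (κ∈ κ∈K t))))

  -- The points killed by `p` form a subgroup invariant under the stabilizer; it contains `β`, so it
  -- cannot be trivial.
  torsion-subgroup : Primitive G → ∀ p {β} → β ≢ o → p • β ≡ o → ∀ x → p • x ≡ o
  torsion-subgroup prim p {β} β≢o pβ x = conclude (invariant-subgroup prim (λ x → does ((p • x) ≟ o))
    (∈B (•-o p))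
    (λ {x} {y} s t → ∈B (trans (×-distrib-+ x y p) (trans (cong₂ _+_ (B∈ s) (B∈ t)) (identityˡ o))))
    (λ {x} s → ∈B (trans (sym (identityˡ _)) (trans (cong (_+ p • (- x)) (sym (B∈ s)))
      (trans (sym (×-distrib-+ x (- x) p)) (trans (cong (p •_) (inverseʳ x)) (•-o p))))))
    (λ {κ} κ∈K {x} s → ∈B (trans (sym (additive-• (stab-additive κ∈K) p x))
      (trans (cong (to κ) (B∈ s)) (proj₂ κ∈K)))))
    where
    ∈B : ∀ {x} → p • x ≡ o → T (does ((p • x) ≟ o))
    ∈B {x} = Equivalence.from (T-does ((p • x) ≟ o))
    B∈ : ∀ {x} → T (does ((p • x) ≟ o)) → p • x ≡ o
    B∈ {x} = Equivalence.to (T-does ((p • x) ≟ o))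
    •-o : ∀ n → n • o ≡ o
    •-o zero    = refl
    •-o (suc n) = trans (identityˡ _) (•-o n)
    conclude : (∀ x → T (does ((p • x) ≟ o)) → x ≡ o) ⊎ (∀ x → T (does ((p • x) ≟ o))) → p • x ≡ o
    conclude (inj₁ trivial) = contradiction (trivial β (∈B pβ)) β≢o
    conclude (inj₂ all)     = B∈ (all x)

  nonzero-point : Primitive G → ∃ λ x → x ≢ o
  nonzero-point prim with α , β , α≢β ← Primitive.nontrivial prim with α ≟ o
  ... | no α≢o  = α , α≢o
  ... | yes α≡o = β , λ β≡o → α≢β (trans α≡o (sym β≡o))

  elementary : Primitive G → ∃ λ p → Prime p × (∀ x → p • x ≡ o)
  elementary prim with p , β , p-prime , β≢o , pβ ← prime-torsion (proj₂ (nonzero-point prim)) =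
    p , p-prime , torsion-subgroup prim p β≢o pβ

  -- Systems of imprimitivity

  -- Says at once that `g` maps the image of `π i` onto that of `π j` and the kernel onto the
  -- kernel. As an equation between maps it is decidable and composes without mention of subsets.
  Intertwines : {t : ℕ} → (Fin t → A → A) → A ↔ A → Fin t → Fin t → Set
  Intertwines π g i j = ∀ x → to g (π i x) ≡ π j (to g x)

  -- A decomposition into nonzero summands permuted by the stabilizer, given by its projections.
  record IsSystem {t : ℕ} (π : Fin t → A → A) : Set where
    field
      additive   : ∀ i x y → π i (x + y) ≡ π i x + π i y
      idempotent : ∀ i x → π i (π i x) ≡ π i x
      orthogonal : ∀ i j → i ≢ j → ∀ x → π i (π j x) ≡ o
      joint      : ∀ x → (∀ i → π i x ≡ o) → x ≡ o
      nonzero    : ∀ i → ∃ λ x → π i x ≢ o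
      permuted   : ∀ g → g ∈ Mem G → to g o ≡ o → ∀ i → ∃ λ j → Intertwines π g i j

  HasSystem : ℕ → Set
  HasSystem t = ∃ λ (π : Fin t → A → A) → IsSystem π

  intertwines? : ∀ {t} (π : Fin t → A → A) g i j → Dec (Intertwines π g i j)
  intertwines? π g i j = all? Ω λ x → to g (π i x) ≟ π j (to g x)

  intertwines-resp : ∀ {t} (π : Fin t → A → A) {g h} i j → g ≗ₚ h → Intertwines π g i j → Intertwines π h i j
  intertwines-resp π i j g≗h eq x = trans (sym (g≗h _)) (trans (eq x) (cong (π j) (g≗h x)))

  opaque
    hasSystem? : Decidable HasSystem
    hasSystem? t = map′
      (λ (f , s) → curry f , s) (λ (f , s) → uncurry f , s)
      (searchMaps (productSet (finSet t) Ω) (searchCarrier Ω) resp (λ f → system? (curry f)))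
      where
      resp : ∀ {f g : Fin t × A → A} → f ≗ g → IsSystem (curry f) → IsSystem (curry g)
      resp {f} {g} f≗g system = record
        { additive   = λ i x y → trans (sym (f≗g _)) (trans (additive i x y) (cong₂ _+_ (f≗g _) (f≗g _)))
        ; idempotent = λ i x → trans (sym (twice i i x)) (trans (idempotent i x) (f≗g _))
        ; orthogonal = λ i j i≢j x → trans (sym (twice i j x)) (orthogonal i j i≢j x)
        ; joint      = λ x eq → joint x λ i → trans (f≗g _) (eq i)
        ; nonzero    = λ i → let (x , neq) = nonzero i in x , λ eq → neq (trans (f≗g _) eq)
        ; permuted   = λ h h∈ ho i → let (j , eq) = permuted h h∈ ho i in
            j , λ x → trans (cong (to h) (sym (f≗g _))) (trans (eq x) (f≗g _))
        }
        where
        open IsSystem system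
        twice : ∀ i j x → f (i , f (j , x)) ≡ g (i , g (j , x))
        twice i j x = trans (f≗g _) (cong (λ y → g (i , y)) (f≗g _))
      system? : (π : Fin t → A → A) → Dec (IsSystem π)
      system? π = map′
        (λ (p , q , r , s , u , v) → record
          { additive = p ; idempotent = q ; orthogonal = r ; joint = s ; nonzero = u ; permuted = v })
        (λ s → let open IsSystem s in additive , idempotent , orthogonal , joint , nonzero , permuted)
        ( Fin.all? (λ i → all? Ω λ x → all? Ω λ y → π i (x + y) ≟ (π i x + π i y))
        ×-dec Fin.all? (λ i → all? Ω λ x → π i (π i x) ≟ π i x)
        ×-dec Fin.all? (λ i → Fin.all? λ j → ¬? (i Fin.≟ j) →-dec all? Ω λ x → π i (π j x) ≟ o)
        ×-dec all? Ω (λ x → Fin.all? (λ i → π i x ≟ o) →-dec (x ≟ o))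
        ×-dec Fin.all? (λ i → searchCarrier Ω λ x → ¬? (π i x ≟ o))
        ×-dec allPermutations Ω G
          (λ {g} {h} g≗h inter ho i → let (j , eq) = inter (trans (g≗h o) ho) i in j , intertwines-resp π {g} {h} i j g≗h eq)
          λ g → (to g o ≟ o) →-dec Fin.all? λ i → Fin.any? λ j → intertwines? π g i j)

  module System {t : ℕ} {π : Fin t → A → A} (system : IsSystem π) where
    open IsSystem system public

    π-o : ∀ i → π i o ≡ o
    π-o i = additive-o (additive i)

    joint-injective : ∀ x y → (∀ i → π i x ≡ π i y) → x ≡ y
    joint-injective x y eq = x∙y⁻¹≈ε⇒x≈y x y (joint _ λ i → trans (additive i x (- y))
      (trans (cong₂ _+_ (eq i) (additive-neg (additive i) y)) (inverseʳ (π i y))))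

    intertwines-∘ : ∀ {g h i j k} → Intertwines π g j k → Intertwines π h i j → Intertwines π (g ↔-∘ h) i k
    intertwines-∘ {g} {h} p q x = trans (cong (to g) (q x)) (p (to h x))

    intertwines-inv : ∀ {g i j} → Intertwines π g i j → Intertwines π (↔-sym g) j i
    intertwines-inv {g} {i} {j} p x = trans
      (cong (from g) (trans (cong (π j) (sym (strictlyInverseˡ g x))) (sym (p (from g x)))))
      (strictlyInverseʳ g _)

    π-distinct : ∀ {i j} → (∀ x → π i x ≡ π j x) → i ≡ j
    π-distinct {i} {j} eq with i Fin.≟ j
    ... | yes i≡j = i≡j
    ... | no  i≢j with x , neq ← nonzero i = contradiction
      (trans (sym (idempotent i x)) (trans (cong (π i) (eq x)) (orthogonal i j i≢j x))) neq

    intertwines-unique : ∀ {g i j k} → Intertwines π g i j → Intertwines π g i k → j ≡ k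
    intertwines-unique {g} {i} {j} {k} p q = π-distinct λ x → begin
      π j x                ≡⟨ cong (π j) (strictlyInverseˡ g x) ⟨
      π j (to g (from g x)) ≡⟨ p _ ⟨
      to g (π i (from g x)) ≡⟨ q _ ⟩
      π k (to g (from g x)) ≡⟨ cong (π k) (strictlyInverseˡ g x) ⟩
      π k x                ∎
      where open ≡-Reasoning

    -- Nonzero points chosen from different summands are different. This bounds the search for the
    -- largest system.
    indices≤size : t ≤ size
    indices≤size = Fin.injective⇒≤ {f = λ i → to enum (π i (proj₁ (nonzero i)))} λ {i} {j} eq → same i j
      (trans (sym (strictlyInverseʳ enum _)) (trans (cong (from enum) eq) (strictlyInverseʳ enum _)))
      where
      same : ∀ i j → π i (proj₁ (nonzero i)) ≡ π j (proj₁ (nonzero j)) → i ≡ j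
      same i j eq with i Fin.≟ j
      ... | yes i≡j = i≡j
      ... | no  i≢j = contradiction
        (trans (sym (idempotent i _)) (trans (cong (π i) eq) (orthogonal i j i≢j _))) (proj₂ (nonzero i))

    Induces : A ↔ A → Fin t ↔ Fin t → Set
    Induces g l = ∀ i → Intertwines π g i (to l i)

    top : PermGroup (Fin t)
    top = record
      { Mem  = λ l → Σ[ g ∈ A ↔ A ] g ∈ Mem G × (to g o ≡ o × Induces g l)
      ; mem? = λ l → anyPermutation Ω G
          (λ {g} {h} g≗h (go , eq) → trans (sym (g≗h o)) go , λ i → intertwines-resp π {g} {h} i (to l i) g≗h (eq i))
          (λ g → (to g o ≟ o) ×-dec Fin.all? λ i → intertwines? π g i (to l i))
      ; resp = λ { l≗l′ (g , g∈ , go , eq) → g , g∈ , go , λ i → subst (Intertwines π g i) (l≗l′ i) (eq i) }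
      ; id∈  = ↔-id A , G.id∈ , refl , λ i x → refl
      ; ∘∈   = λ { {l} {l′} (g , g∈ , go , eq) (h , h∈ , ho , eq′) →
          g ↔-∘ h , G.∘∈ g∈ h∈ , trans (cong (to g) ho) go ,
          λ i → intertwines-∘ {g} {h} (eq (to l′ i)) (eq′ i) }
      ; inv∈ = λ { {l} (g , g∈ , go , eq) → ↔-sym g , G.inv∈ g∈ , proj₂ (stab-inv (g∈ , go)) ,
          λ i → intertwines-inv {g} (subst (Intertwines π g (from l i)) (strictlyInverseˡ l i) (eq (from l i))) }
      }

    -- The target index of each summand is unique, so the assignments obtained from `g` and from its
    -- inverse are mutually inverse.
    induced : ∀ {g} → g ∈ Stab → Σ[ l ∈ Fin t ↔ Fin t ] l ∈ Mem top × Induces g l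
    induced {g} stab@(g∈ , go) = l , (g , g∈ , go , inter) , inter
      where
      there back : ∀ i → Σ (Fin t) _
      there = permuted g g∈ go
      back = permuted (↔-sym g) (proj₁ (stab-inv stab)) (proj₂ (stab-inv stab))
      l : Fin t ↔ Fin t
      l = mk↔ₛ′ (proj₁ ∘ there) (proj₁ ∘ back)
        (λ i → intertwines-unique {g} (proj₂ (there (proj₁ (back i)))) (intertwines-inv {↔-sym g} (proj₂ (back i))))
        (λ i → intertwines-unique {↔-sym g} (proj₂ (back (proj₁ (there i)))) (intertwines-inv {g} (proj₂ (there i))))
      inter : Induces g l
      inter i = proj₂ (there i)

    -- The summands in the orbit of the i-th one span an invariant subgroup.
    opaque
      intertwiner : Primitive G → ∀ i j → Σ[ g ∈ A ↔ A ] g ∈ Mem G × (to g o ≡ o × Intertwines π g i j)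
      intertwiner prim i j = conclude (invariant-subgroup prim B o∈ +∈ -∈ κ∈)
        where
        Linked : Fin t → Set
        Linked j = Σ[ g ∈ A ↔ A ] g ∈ Mem G × (to g o ≡ o × Intertwines π g i j)
        inOrbit? : ∀ x → Dec (∀ j → Linked j ⊎ π j x ≡ o)
        inOrbit? x = Fin.all? λ j → anyPermutation Ω G
            (λ {g} {h} g≗h (go , eq) → trans (sym (g≗h o)) go , intertwines-resp π {g} {h} i j g≗h eq)
            (λ g → (to g o ≟ o) ×-dec intertwines? π g i j)
          ⊎-dec (π j x ≟ o)
        B : A → Bool
        B = does ∘ inOrbit?
        o∈ : T (B o)
        o∈ = Equivalence.from (T-does (inOrbit? o)) λ j → inj₂ (π-o j)
        +∈ : ∀ {x y} → T (B x) → T (B y) → T (B (x + y))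
        +∈ {x} {y} s u = Equivalence.from (T-does (inOrbit? (x + y))) λ j →
          add (Equivalence.to (T-does (inOrbit? x)) s j) (Equivalence.to (T-does (inOrbit? y)) u j)
          where
          add : ∀ {j} → Linked j ⊎ π j x ≡ o → Linked j ⊎ π j y ≡ o → Linked j ⊎ π j (x + y) ≡ o
          add (inj₁ l) _        = inj₁ l
          add _        (inj₁ l) = inj₁ l
          add (inj₂ p) (inj₂ q) = inj₂ (trans (additive _ x y) (trans (cong₂ _+_ p q) (identityˡ o)))
        -∈ : ∀ {x} → T (B x) → T (B (- x))
        -∈ {x} s = Equivalence.from (T-does (inOrbit? (- x))) λ j →
          neg (Equivalence.to (T-does (inOrbit? x)) s j)
          where
          neg : ∀ {j} → Linked j ⊎ π j x ≡ o → Linked j ⊎ π j (- x) ≡ o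
          neg (inj₁ l) = inj₁ l
          neg (inj₂ p) = inj₂ (trans (additive-neg (additive _) x)
            (trans (cong -_ p) (sym (inverseʳ-unique o o (identityˡ o)))))
        κ∈ : ∀ {κ} → κ ∈ Stab → ∀ {x} → T (B x) → T (B (to κ x))
        κ∈ {κ} κ∈K {x} s = Equivalence.from (T-does (inOrbit? (to κ x))) move
          where
          move : ∀ j → Linked j ⊎ π j (to κ x) ≡ o
          move j with l , _ , inter ← induced κ∈K
                 with inter′ ← subst (Intertwines π κ (from l j)) (strictlyInverseˡ l j) (inter (from l j))
                 with Equivalence.to (T-does (inOrbit? x)) s (from l j)
          ... | inj₁ (g , g∈ , go , eq) = inj₁ (κ ↔-∘ g , G.∘∈ (proj₁ κ∈K) g∈ ,
                  proj₂ (stab-∘ {κ} {g} κ∈K (g∈ , go)) , intertwines-∘ {κ} {g} inter′ eq)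
          ... | inj₂ p = inj₂ (trans (sym (inter′ x)) (trans (cong (to κ) p) (proj₂ κ∈K)))
        conclude : (∀ x → T (B x) → x ≡ o) ⊎ (∀ x → T (B x)) → Linked j
        conclude (inj₁ trivial) with w , neq ← nonzero i = contradiction
          (trivial (π i w) (Equivalence.from (T-does (inOrbit? (π i w))) at)) neq
          where
          at : ∀ k → Linked k ⊎ π k (π i w) ≡ o
          at k with k Fin.≟ i
          ... | yes refl = inj₁ (↔-id A , G.id∈ , refl , λ x → refl)
          ... | no  k≢i  = inj₂ (orthogonal k i k≢i w)
        conclude (inj₂ all) with w , neq ← nonzero j with Equivalence.to (T-does (inOrbit? w)) (all w) j
        ... | inj₁ linked = linked
        ... | inj₂ p      = contradiction p neq

  maximalSystem : Primitive G → ∃ λ t → HasSystem t × (∀ s → t < s → ¬ HasSystem s)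
  maximalSystem prim = largest hasSystem? size (λ t (π , system) → System.indices≤size system)
    (1 , (λ _ x → x) , record
      { additive   = λ _ _ _ → refl
      ; idempotent = λ _ _ → refl
      ; orthogonal = λ { zero zero 0≢0 → contradiction refl 0≢0 }
      ; joint      = λ x eq → eq zero
      ; nonzero    = λ _ → nonzero-point prim
      ; permuted   = λ _ _ _ _ → zero , λ _ → refl
      })

  -- Coordinates over the prime field

  module Basis (p : ℕ) (p-prime : Prime p) (torsion : ∀ x → p • x ≡ o) where
    private instance
      p-nonZero : NonZero p
      p-nonZero = prime⇒nonZero p-prime

    module _ (d : ℕ) where
      open LinearAlgebra p d public using (V)

    module _ {d : ℕ} where
      open LinearAlgebra p d public using (𝟎; _⊕_; _·_; ∑)

    -- Multiples of `p` annihilate every point, so only the remainder matters. This is what turns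
    -- natural multiples into scalars from `Fin p`.
    mod-• : ∀ n x → toℕ (n mod p) • x ≡ n • x
    mod-• n x = begin
      toℕ (n mod p) • x                      ≡⟨ cong (_• x) (Fin.toℕ-fromℕ< (m%n<n n p)) ⟩
      (n % p) • x                            ≡⟨ identityʳ _ ⟨
      (n % p) • x + o                        ≡⟨ cong ((n % p) • x +_) (multiple (n / p)) ⟨
      (n % p) • x + (n / p ℕ.* p) • x        ≡⟨ ×-homo-+ x (n % p) (n / p ℕ.* p) ⟨
      (n % p ℕ.+ n / p ℕ.* p) • x            ≡⟨ cong (_• x) (m≡m%n+[m/n]*n n p) ⟨
      n • x                                  ∎
      where
      open ≡-Reasoning
      multiple : ∀ k → (k ℕ.* p) • x ≡ o
      multiple k = trans (cong (_• x) (ℕ.*-comm k p)) (trans (sym (×-assocˡ x p k)) (torsion _))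

    neg-• : ∀ x → - x ≡ pred p • x
    neg-• x = sym (inverseʳ-unique x _ (trans (cong (_• x) (ℕ.suc-pred p)) (torsion x)))

    comb : ∀ {d} → Vec A d → V d → A
    comb []       []      = o
    comb (w ∷ ws) (c ∷ v) = toℕ c • w + comb ws v

    comb-⊕ : ∀ {d} (ws : Vec A d) u v → comb ws (u ⊕ v) ≡ comb ws u + comb ws v
    comb-⊕ []       []      []       = sym (identityˡ o)
    comb-⊕ (w ∷ ws) (a ∷ u) (b ∷ v) = trans
      (cong₂ _+_ (trans (mod-• (toℕ a ℕ.+ toℕ b) w) (×-homo-+ w (toℕ a) (toℕ b))) (comb-⊕ ws u v))
      (interchange _ _ _ _)

    comb-· : ∀ {d} (ws : Vec A d) c v → comb ws (c · v) ≡ toℕ c • comb ws v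
    comb-· []       c []      = sym (multiple-o (toℕ c))
      where
      multiple-o : ∀ n → n • o ≡ o
      multiple-o zero    = refl
      multiple-o (suc n) = trans (identityˡ _) (multiple-o n)
    comb-· (w ∷ ws) c (a ∷ v) = trans
      (cong₂ _+_ (trans (mod-• (toℕ c ℕ.* toℕ a) w) (sym (×-assocˡ w (toℕ c) (toℕ a)))) (comb-· ws c v))
      (sym (×-distrib-+ (toℕ a • w) (comb ws v) (toℕ c)))

    comb-𝟎 : ∀ {d} (ws : Vec A d) → comb ws 𝟎 ≡ o
    comb-𝟎 []       = refl
    comb-𝟎 (w ∷ ws) = trans (cong₂ _+_ (mod-• 0 w) (comb-𝟎 ws)) (identityˡ o)

    Spanned : ∀ {d} → Vec A d → Pred A 0ℓ
    Spanned {d} ws x = ∃ λ (v : V d) → comb ws v ≡ x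

    Independent : ∀ {d} → Vec A d → Set
    Independent ws = ∀ u v → comb ws u ≡ comb ws v → u ≡ v

    module _ {d : ℕ} (ws : Vec A d) where

      spanned-+ : ∀ {x y} → Spanned ws x → Spanned ws y → Spanned ws (x + y)
      spanned-+ (u , refl) (v , refl) = u ⊕ v , comb-⊕ ws u v

      spanned-• : ∀ n {x} → Spanned ws x → Spanned ws (n • x)
      spanned-• zero    _ = 𝟎 , comb-𝟎 ws
      spanned-• (suc n) s = spanned-+ s (spanned-• n s)

      spanned-neg : ∀ {x} → Spanned ws x → Spanned ws (- x)
      spanned-neg {x} s = subst (Spanned ws) (sym (neg-• x)) (spanned-• (pred p) s)

      -- Bézout: some multiple of 1 + k is 1 modulo p.
      spanned-divide : ∀ k w → suc k < p → Spanned ws (suc k • w) → Spanned ws w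
      spanned-divide k w k<p s with coprime-Bézout (prime⇒coprime p-prime k<p)
      ... | Bézout.+- x y eq = subst (Spanned ws)
        (sym (inverseˡ-unique w (y • (suc k • w)) (begin
          w + y • (suc k • w)      ≡⟨ cong (w +_) (×-assocˡ w y (suc k)) ⟩
          (1 ℕ.+ y ℕ.* suc k) • w  ≡⟨ cong (_• w) (trans eq (ℕ.*-comm x p)) ⟩
          (p ℕ.* x) • w            ≡⟨ ×-assocˡ w p x ⟨
          p • (x • w)              ≡⟨ torsion _ ⟩
          o                        ∎)))
        (spanned-neg (spanned-• y s))
        where open ≡-Reasoning
      ... | Bézout.-+ x y eq = subst (Spanned ws) (begin
          y • (suc k • w)          ≡⟨ ×-assocˡ w y (suc k) ⟩
          (y ℕ.* suc k) • w        ≡⟨ cong (_• w) eq ⟨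
          w + (x ℕ.* p) • w        ≡⟨ cong (λ n → w + n • w) (ℕ.*-comm x p) ⟩
          w + (p ℕ.* x) • w        ≡⟨ cong (w +_) (trans (sym (×-assocˡ w p x)) (torsion _)) ⟩
          w + o                    ≡⟨ identityʳ w ⟩
          w                        ∎)
        (spanned-• y s)
        where open ≡-Reasoning

      -- Subtracting the two combinations puts a multiple of `w` by `b - a` into the span, and a
      -- number strictly between `0` and `p` can be divided out. The order `a < b` keeps the
      -- difference a natural number.
      coefficient-gap : ∀ {w} a b {x y} → a < b → b < p → Spanned ws x → Spanned ws y →
                        a • w + x ≡ b • w + y → Spanned ws w
      coefficient-gap {w} a b {x} {y} a<b b<p s s′ eq with k , refl ← ℕ.m≤n⇒∃[o]m+o≡n a<b =
        spanned-divide k w (ℕ.≤-<-trans (s≤s (ℕ.m≤n+m k a)) b<p)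
          (subst (Spanned ws) (begin
            x + (- y)                   ≡⟨ cong (_+ (- y)) (∙-cancelˡ (a • w) _ _ (begin
              a • w + x                   ≡⟨ eq ⟩
              suc (a ℕ.+ k) • w + y       ≡⟨ cong (λ n → n • w + y) (ℕ.+-suc a k) ⟨
              (a ℕ.+ suc k) • w + y       ≡⟨ cong (_+ y) (×-homo-+ w a (suc k)) ⟩
              a • w + suc k • w + y       ≡⟨ assoc _ _ _ ⟩
              a • w + (suc k • w + y)     ∎)) ⟩
            suc k • w + y + (- y)       ≡⟨ assoc _ _ _ ⟩
            suc k • w + (y + (- y))     ≡⟨ cong (suc k • w +_) (inverseʳ y) ⟩
            suc k • w + o               ≡⟨ identityʳ _ ⟩
            suc k • w                   ∎)
            (spanned-+ s (spanned-neg s′)))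
        where open ≡-Reasoning

      independent-∷ : ∀ {w} → ¬ Spanned ws w → Independent ws → Independent (w ∷ ws)
      independent-∷ {w} w∉ independent (a ∷ u) (b ∷ v) eq with ℕ.<-cmp (toℕ a) (toℕ b)
      ... | tri< a<b _ _ = contradiction
        (coefficient-gap _ _ a<b (Fin.toℕ<n b) (u , refl) (v , refl) eq) w∉
      ... | tri> _ _ b<a = contradiction
        (coefficient-gap _ _ b<a (Fin.toℕ<n a) (v , refl) (u , refl) (sym eq)) w∉
      ... | tri≈ _ a≡b _ with refl ← Fin.toℕ-injective a≡b =
        cong (a ∷_) (independent u v (∙-cancelˡ (toℕ a • w) _ _ eq))

    opaque
      spanned? : ∀ {d} (ws : Vec A d) → Decidable (Spanned ws)
      spanned? {d} ws x = searchVec Fin.any? d λ v → comb ws v ≟ x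

    opaque
      -- Greedy choice: a point is added to the list exactly when the later ones do not span it. The
      -- predicate `Q`, closed under sums, keeps the span inside a given subgroup.
      basis : (Q : Pred A 0ℓ) → Q o → (∀ {x y} → Q x → Q y → Q (x + y)) → ∀ {n} (xs : Fin n → A) → (∀ i → Q (xs i)) →
              ∃₂ λ d (ws : Vec A d) → Independent ws × (∀ v → Q (comb ws v)) × (∀ i → Spanned ws (xs i))
      basis Q Qo Q+ {zero}  xs Qxs = 0 , [] , (λ { [] [] _ → refl }) , (λ { [] → Qo }) , λ ()
      basis Q Qo Q+ {suc n} xs Qxs with basis Q Qo Q+ (xs ∘ suc) (Qxs ∘ suc)
      ... | d , ws , independent , inside , spans with spanned? ws (xs zero)
      ...   | yes s = d , ws , independent , inside , λ { zero → s ; (suc i) → spans i }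
      ...   | no ¬s = suc d , xs zero ∷ ws , independent-∷ ws ¬s independent ,
        (λ { (c ∷ v) → Q+ (Q• (toℕ c) (Qxs zero)) (inside v) }) ,
        (λ { zero    → unit ∷ 𝟎 , trans (cong₂ _+_ (mod-• 1 (xs zero)) (comb-𝟎 ws)) (trans (identityʳ _) (identityʳ _))
           ; (suc i) → let (v , eq) = spans i in 0 mod p ∷ v , trans (cong₂ _+_ (mod-• 0 (xs zero)) eq) (identityˡ _) })
        where
        unit : Fin p
        unit = 1 mod p
        Q• : ∀ n {x} → Q x → Q (n • x)
        Q• zero    _ = Qo
        Q• (suc n) q = Q+ q (Q• n q)

  -- The primitive component and its wreath product

  module Frame (prim : Primitive G) (p : ℕ) (p-prime : Prime p) (torsion : ∀ x → p • x ≡ o)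
               {t : ℕ} {π : Fin t → A → A} (system : IsSystem π) (i₀ : Fin t) where
    open System system
    open Basis p p-prime torsion

    record Coordinates : Set where
      field
        dim         : ℕ
        vectors     : Vec A dim
        independent : Independent vectors
        inside      : ∀ v → π i₀ (comb vectors v) ≡ comb vectors v
        spanning    : ∀ x → Spanned vectors (π i₀ x)

    opaque
      coordinates : Coordinates
      coordinates with d , ws , independent , inside , spans ← basis (λ x → π i₀ x ≡ x) (π-o i₀)
          (λ {x} {y} p q → trans (additive i₀ x y) (cong₂ _+_ p q))
          (π i₀ ∘ from enum) (λ i → idempotent i₀ (from enum i)) = record
        { dim = d ; vectors = ws ; independent = independent ; inside = inside
        ; spanning = λ x → subst (Spanned ws ∘ π i₀) (strictlyInverseʳ enum x) (spans (to enum x)) }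

    open Coordinates coordinates using (dim)
    private module C = Coordinates coordinates

    W : Set
    W = V dim

    Γ : FiniteSet
    Γ = vecSet (finSet p) dim

    ι : W → A
    ι = comb C.vectors

    ρ : A → W
    ρ x = proj₁ (C.spanning x)

    ι-injective : ∀ {u v} → ι u ≡ ι v → u ≡ v
    ι-injective = C.independent _ _

    ι-⊕ : ∀ u v → ι (u ⊕ v) ≡ ι u + ι v
    ι-⊕ = comb-⊕ C.vectors

    ι-𝟎 : ι 𝟎 ≡ o
    ι-𝟎 = comb-𝟎 C.vectors

    ι-ρ : ∀ x → ι (ρ x) ≡ π i₀ x
    ι-ρ x = proj₂ (C.spanning x)

    ρ-ι : ∀ v → ρ (ι v) ≡ v
    ρ-ι v = ι-injective (trans (ι-ρ (ι v)) (C.inside v))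

    -- The group laws of `W` are inherited from `A` along the injective additive map `ι`, which
    -- avoids modular arithmetic.
    ⊕-comm : ∀ u v → u ⊕ v ≡ v ⊕ u
    ⊕-comm u v = ι-injective (trans (ι-⊕ u v) (trans (comm _ _) (sym (ι-⊕ v u))))

    ⊕-assoc : ∀ u v w → (u ⊕ v) ⊕ w ≡ u ⊕ (v ⊕ w)
    ⊕-assoc u v w = ι-injective (trans (trans (ι-⊕ _ w) (cong (_+ ι w) (ι-⊕ u v)))
      (trans (assoc _ _ _) (sym (trans (ι-⊕ u _) (cong (ι u +_) (ι-⊕ v w))))))

    ⊕-identityˡ : ∀ v → 𝟎 ⊕ v ≡ v
    ⊕-identityˡ v = ι-injective (trans (ι-⊕ 𝟎 v) (trans (cong (_+ ι v) ι-𝟎) (identityˡ _)))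

    ρ-+ : ∀ x y → ρ (x + y) ≡ ρ x ⊕ ρ y
    ρ-+ x y = ι-injective (begin
      ι (ρ (x + y))       ≡⟨ ι-ρ _ ⟩
      π i₀ (x + y)        ≡⟨ additive i₀ x y ⟩
      π i₀ x + π i₀ y     ≡⟨ cong₂ _+_ (ι-ρ x) (ι-ρ y) ⟨
      ι (ρ x) + ι (ρ y)   ≡⟨ ι-⊕ _ _ ⟨
      ι (ρ x ⊕ ρ y)       ∎)
      where open ≡-Reasoning

    -- A fixed choice of stabilizer elements moving the summand `i₀` to each summand `i`. Through it
    -- all summands share the coordinate space `W`.
    k : Fin t → A ↔ A
    k i = proj₁ (intertwiner prim i₀ i)

    k∈ : ∀ i → k i ∈ Stab
    k∈ i = let (_ , g∈ , go , _) = intertwiner prim i₀ i in g∈ , go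

    k-intertwines : ∀ i → Intertwines π (k i) i₀ i
    k-intertwines i = proj₂ (proj₂ (proj₂ (intertwiner prim i₀ i)))

    ι′ : Fin t → W → A
    ι′ i v = to (k i) (ι v)

    ρ′ : Fin t → A → W
    ρ′ i x = ρ (from (k i) x)

    ι′-ρ′ : ∀ i x → ι′ i (ρ′ i x) ≡ π i x
    ι′-ρ′ i x = begin
      to (k i) (ι (ρ (from (k i) x)))   ≡⟨ cong (to (k i)) (ι-ρ _) ⟩
      to (k i) (π i₀ (from (k i) x))    ≡⟨ k-intertwines i _ ⟩
      π i (to (k i) (from (k i) x))     ≡⟨ cong (π i) (strictlyInverseˡ (k i) x) ⟩
      π i x                             ∎
      where open ≡-Reasoning

    ρ′-ι′ : ∀ i v → ρ′ i (ι′ i v) ≡ v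
    ρ′-ι′ i v = trans (cong ρ (strictlyInverseʳ (k i) _)) (ρ-ι v)

    ι′-injective : ∀ i {u v} → ι′ i u ≡ ι′ i v → u ≡ v
    ι′-injective i {u} {v} eq = trans (sym (ρ′-ι′ i u)) (trans (cong (ρ′ i) eq) (ρ′-ι′ i v))

    ι′-inside : ∀ i v → π i (ι′ i v) ≡ ι′ i v
    ι′-inside i v = trans (sym (ι′-ρ′ i _)) (cong (ι′ i) (ρ′-ι′ i v))

    ι′-⊕ : ∀ i u v → ι′ i (u ⊕ v) ≡ ι′ i u + ι′ i v
    ι′-⊕ i u v = trans (cong (to (k i)) (ι-⊕ u v)) (stab-additive (k∈ i) _ _)

    ι′-𝟎 : ∀ i → ι′ i 𝟎 ≡ o
    ι′-𝟎 i = trans (cong (to (k i)) ι-𝟎) (proj₂ (k∈ i))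

    ρ′-+ : ∀ i x y → ρ′ i (x + y) ≡ ρ′ i x ⊕ ρ′ i y
    ρ′-+ i x y = trans (cong ρ (stab-additive (stab-inv (k∈ i)) x y)) (ρ-+ _ _)

    ρ′-o : ∀ i → ρ′ i o ≡ 𝟎
    ρ′-o i = trans (cong (ρ′ i) (sym (ι′-𝟎 i))) (ρ′-ι′ i 𝟎)

    ρ′-ι′-other : ∀ i j → i ≢ j → ∀ v → ρ′ i (ι′ j v) ≡ 𝟎
    ρ′-ι′-other i j i≢j v = ι′-injective i (begin
      ι′ i (ρ′ i (ι′ j v))   ≡⟨ ι′-ρ′ i _ ⟩
      π i (ι′ j v)           ≡⟨ cong (π i) (ι′-inside j v) ⟨
      π i (π j (ι′ j v))     ≡⟨ orthogonal i j i≢j _ ⟩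
      o                      ≡⟨ ι′-𝟎 i ⟨
      ι′ i 𝟎                 ∎)
      where open ≡-Reasoning

    ρ′-joint : ∀ {x y} → (∀ i → ρ′ i x ≡ ρ′ i y) → x ≡ y
    ρ′-joint {x} {y} eq = joint-injective x y λ i →
      trans (sym (ι′-ρ′ i x)) (trans (cong (ι′ i) (eq i)) (ι′-ρ′ i y))

    split : A ↔ Vec W t
    split = mk↔ₛ′ (λ x → tabulate λ i → ρ′ i x) (λ a → sum λ i → ι′ i (lookup a i))
      (λ a → vec-ext λ j → trans (lookup∘tabulate _ j) (ρ′-sum (lookup a) j))
      -- That a point is the sum of its projections comes from `joint`: both have the same
      -- coordinates.
      (λ x → ρ′-joint λ j → trans (ρ′-sum _ j) (lookup∘tabulate _ j))
      where
      ρ′-sum : ∀ a j → ρ′ j (sum λ i → ι′ i (a i)) ≡ a j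
      ρ′-sum a j = ι′-injective j (begin
        ι′ j (ρ′ j (sum λ i → ι′ i (a i)))  ≡⟨ ι′-ρ′ j _ ⟩
        π j (sum λ i → ι′ i (a i))          ≡⟨ additive-sum (additive j) (λ i → ι′ i (a i)) ⟩
        sum (λ i → π j (ι′ i (a i)))        ≡⟨ sum-single (λ i → π j (ι′ i (a i))) j (λ i i≢j → trans
                                                 (cong (π j) (sym (ι′-inside i (a i))))
                                                 (orthogonal j i (i≢j ∘ sym) _)) ⟩
        π j (ι′ j (a j))                    ≡⟨ ι′-inside j (a j) ⟩
        ι′ j (a j)                          ∎)
        where open ≡-Reasoning

    Restricts : A ↔ A → W ↔ W → Set
    Restricts g h = ∀ v → to g (ι v) ≡ ι (to h v)

    restricts-inv : ∀ {g h} → Restricts g h → Restricts (↔-sym g) (↔-sym h)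
    restricts-inv {g} {h} eq v = trans
      (cong (from g) (trans (cong ι (sym (strictlyInverseˡ h v))) (sym (eq _)))) (strictlyInverseʳ g _)

    -- The lift `g` ranges over all of `G` and not only over the stabilizer of `o`, so the
    -- translations along the summand are included.
    component : PermGroup W
    component = record
      { Mem  = λ h → Σ[ g ∈ A ↔ A ] g ∈ Mem G × Restricts g h
      ; mem? = λ h → anyPermutation Ω G (λ g≗g′ eq v → trans (sym (g≗g′ _)) (eq v))
                       (λ g → all? Γ λ v → to g (ι v) ≟ ι (to h v))
      ; resp = λ h≗h′ (g , g∈ , eq) → g , g∈ , λ v → trans (eq v) (cong ι (h≗h′ v))
      ; id∈  = ↔-id A , G.id∈ , λ v → refl
      ; ∘∈   = λ { {h} {h′} (g , g∈ , eq) (g′ , g′∈ , eq′) → g ↔-∘ g′ , G.∘∈ g∈ g′∈ ,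
                 λ v → trans (cong (to g) (eq′ v)) (eq (to h′ v)) }
      ; inv∈ = λ { {h} (g , g∈ , eq) → ↔-sym g , G.inv∈ g∈ , restricts-inv {g} {h} eq }
      }

    private module H = PermGroup component

    restriction : ∀ {κ} → κ ∈ Stab → Intertwines π κ i₀ i₀ →
                  Σ[ h ∈ W ↔ W ] h ∈ Mem component × to h 𝟎 ≡ 𝟎 × Restricts κ h
    restriction {κ} κ∈ inter = mk↔ₛ′ (ρ ∘ to κ ∘ ι) (ρ ∘ from κ ∘ ι)
        (λ v → ι-injective (trans (sym (there _)) (trans (cong (to κ) (sym (back v))) (strictlyInverseˡ κ _))))
        (λ v → ι-injective (trans (sym (back _)) (trans (cong (from κ) (sym (there v))) (strictlyInverseʳ κ _)))) ,
      (κ , proj₁ κ∈ , there) ,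
      ι-injective (trans (sym (there 𝟎)) (trans (cong (to κ) ι-𝟎) (trans (proj₂ κ∈) (sym ι-𝟎)))) ,
      there
      where
      there : ∀ v → to κ (ι v) ≡ ι (ρ (to κ (ι v)))
      there v = sym (trans (ι-ρ _) (trans (sym (inter (ι v))) (cong (to κ) (C.inside v))))
      back : ∀ v → from κ (ι v) ≡ ι (ρ (from κ (ι v)))
      back v = sym (trans (ι-ρ _) (trans (sym (intertwines-inv {κ} inter (ι v))) (cong (from κ) (C.inside v))))

    shift : ∀ c → Σ[ h ∈ W ↔ W ] h ∈ Mem component × (∀ v → to h v ≡ v ⊕ c)
    shift c with g , g∈ , eq ← translation (ι c) = h , (g , g∈ , λ v → begin
        to g (ι v)    ≡⟨ eq (ι v) ⟩
        ι c + ι v     ≡⟨ comm _ _ ⟩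
        ι v + ι c     ≡⟨ ι-⊕ v c ⟨
        ι (v ⊕ c)     ∎) , λ v → refl
      where
      open ≡-Reasoning
      c⁻ : W
      c⁻ = ρ (- ι c)
      ι-c⁻ : ι c⁻ ≡ - ι c
      ι-c⁻ = trans (ι-ρ _) (trans (additive-neg (additive i₀) (ι c)) (cong -_ (C.inside c)))
      c⁻⊕c : c⁻ ⊕ c ≡ 𝟎
      c⁻⊕c = ι-injective (trans (ι-⊕ c⁻ c) (trans (cong (_+ ι c) ι-c⁻) (trans (inverseˡ _) (sym ι-𝟎))))
      cancel : ∀ a b → a ⊕ b ≡ 𝟎 → ∀ v → (v ⊕ a) ⊕ b ≡ v
      cancel a b eq v = trans (⊕-assoc v a b) (trans (cong (v ⊕_) eq) (trans (⊕-comm v 𝟎) (⊕-identityˡ v)))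
      h : W ↔ W
      h = mk↔ₛ′ (_⊕ c) (_⊕ c⁻) (cancel c⁻ c c⁻⊕c) (cancel c c⁻ (trans (⊕-comm c c⁻) c⁻⊕c))

    -- In the common coordinates, passing from summand `i` to summand `j` by `κ` becomes the action
    -- of `k j` inverse after `κ` after `k i`. This product lies in the stabilizer and preserves the
    -- summand `i₀`, so its restriction belongs to the component.
    acts-linearly : ∀ {κ} → κ ∈ Stab → ∀ i j → Intertwines π κ i j →
                    Σ[ h ∈ W ↔ W ] h ∈ Mem component × to h 𝟎 ≡ 𝟎 × (∀ x → ρ′ j (to κ x) ≡ to h (ρ′ i x))
    acts-linearly {κ} κ∈ i j inter = h , h∈ , h𝟎 , λ x → ι-injective (begin
      ι (ρ (from (k j) (to κ x)))                       ≡⟨ ι-ρ _ ⟩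
      π i₀ (from (k j) (to κ x))                        ≡⟨ cong (π i₀ ∘ from (k j) ∘ to κ) (strictlyInverseˡ (k i) x) ⟨
      π i₀ (to κ′ (from (k i) x))                       ≡⟨ κ′-intertwines (from (k i) x) ⟨
      to κ′ (π i₀ (from (k i) x))                       ≡⟨ cong (to κ′) (ι-ρ _) ⟨
      to κ′ (ι (ρ′ i x))                                ≡⟨ restricts (ρ′ i x) ⟩
      ι (to h (ρ′ i x))                                 ∎)
      where
      open ≡-Reasoning
      κ′ : A ↔ A
      κ′ = ↔-sym (k j) ↔-∘ (κ ↔-∘ k i)
      κ′-intertwines : Intertwines π κ′ i₀ i₀
      κ′-intertwines = intertwines-∘ {↔-sym (k j)} {κ ↔-∘ k i} (intertwines-inv {k j} (k-intertwines j))
        (intertwines-∘ {κ} {k i} inter (k-intertwines i))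
      restricted = restriction {κ′} (stab-∘ {↔-sym (k j)} {κ ↔-∘ k i} (stab-inv (k∈ j)) (stab-∘ {κ} {k i} κ∈ (k∈ i))) κ′-intertwines
      h = proj₁ restricted
      h∈ = proj₁ (proj₂ restricted)
      h𝟎 = proj₁ (proj₂ (proj₂ restricted))
      restricts = proj₂ (proj₂ (proj₂ restricted))

    Ĝ : PermGroup A
    Ĝ = wreath Ω Γ component top split

    -- The linear part of `g` permutes the summands and acts on each of them through the component;
    -- the remaining translation adds to each coordinate that of `to g o`, which is a shift in the
    -- component.
    G⊆Ĝ : Mem G ⊆ Mem Ĝ
    G⊆Ĝ {g} g∈ with κ , κ∈ , g≡ ← linearPart g∈ with l , l∈ , inter ← induced κ∈ = l , l∈ , λ i →
      let (h , h∈ , _ , eq)   = acts-linearly κ∈ i (to l i) (inter i)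
          (h′ , h′∈ , shifts) = shift (ρ′ (to l i) (to g o))
      in h′ ↔-∘ h , H.∘∈ {h′} {h} h′∈ h∈ , λ x → begin
        lookup (to split (to g x)) (to l i)               ≡⟨ lookup∘tabulate _ (to l i) ⟩
        ρ′ (to l i) (to g x)                              ≡⟨ cong (ρ′ (to l i)) (g≡ x) ⟩
        ρ′ (to l i) (to κ x + to g o)                     ≡⟨ ρ′-+ (to l i) _ _ ⟩
        ρ′ (to l i) (to κ x) ⊕ ρ′ (to l i) (to g o)       ≡⟨ cong (_⊕ ρ′ (to l i) (to g o)) (eq x) ⟩
        to h (ρ′ i x) ⊕ ρ′ (to l i) (to g o)              ≡⟨ shifts _ ⟨
        to h′ (to h (ρ′ i x))                             ≡⟨ cong (to h′ ∘ to h) (lookup∘tabulate _ i) ⟨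
        to h′ (to h (lookup (to split x) i))              ∎
      where open ≡-Reasoning

    -- Transitivity, solvability, irreducibility and primitivity

    top-transitive : Transitive top
    top-transitive i j with g , g∈ , go , eq ← intertwiner prim i j with l , l∈ , inter ← induced {g} (g∈ , go) =
      l , l∈ , intertwines-unique {g} (inter i) eq

    component-transitive : Transitive component
    component-transitive u v with h , h∈ , hu ← shift u | h′ , h′∈ , hv ← shift v =
      h′ ↔-∘ ↔-sym h , H.∘∈ {h′} {↔-sym h} h′∈ (H.inv∈ {h} h∈) ,
      trans (cong (to h′) (trans (cong (from h) (sym (trans (hu 𝟎) (⊕-identityˡ u)))) (strictlyInverseʳ h 𝟎)))
        (trans (hv 𝟎) (⊕-identityˡ v))

    -- Every element of a derived term of the component lifts to the same derived term of `G`, so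
    -- both series become trivial at the same index `n`.
    component-solvable : Solvable G → Solvable component
    component-solvable (n , trivial) = n , λ h h∈ v →
      let (g , g∈ , eq) = lift n h∈ in ι-injective (trans (sym (eq v)) (trivial g g∈ (ι v)))
      where
      lift : ∀ n {h} → h ∈ derivedSeries component n → Σ[ g ∈ A ↔ A ] g ∈ derivedSeries G n × Restricts g h
      lift zero    h∈ = h∈
      lift (suc n) = go
        where
        _⊙_ : ∀ {g g′ h h′} → Restricts g h → Restricts g′ h′ → Restricts (g ↔-∘ g′) (h ↔-∘ h′)
        _⊙_ {g} {h′ = h′} eq eq′ v = trans (cong (to g) (eq′ v)) (eq (to h′ v))
        go : ∀ {h} → h ∈ Derived (derivedSeries component n) →
             Σ[ g ∈ A ↔ A ] g ∈ Derived (derivedSeries G n) × Restricts g h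
        go (commutator {a} {b} a∈ b∈) with g , g∈ , eq ← lift n a∈ | g′ , g′∈ , eq′ ← lift n b∈ =
          _ , commutator g∈ g′∈ , _⊙_ {↔-sym g} {↔-sym g′ ↔-∘ (g ↔-∘ g′)} {↔-sym a} {↔-sym b ↔-∘ (a ↔-∘ b)}
            (restricts-inv {g} {a} eq)
            (_⊙_ {↔-sym g′} {g ↔-∘ g′} {↔-sym b} {a ↔-∘ b} (restricts-inv {g′} {b} eq′) (_⊙_ {g} {g′} {a} {b} eq eq′))
        go identity = ↔-id A , identity , λ v → refl
        go (product {a} {b} a∈ b∈) with g , g∈ , eq ← go a∈ | g′ , g′∈ , eq′ ← go b∈ =
          _ , product g∈ g′∈ , _⊙_ {g} {g′} {a} {b} eq eq′
        go (inverse {a} a∈) with g , g∈ , eq ← go a∈ = _ , inverse g∈ , restricts-inv {g} {a} eq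
        go (respects a≗b a∈) with g , g∈ , eq ← go a∈ = g , g∈ , λ v → trans (eq v) (cong ι (a≗b v))

    private module LA = LinearAlgebra p {{prime⇒nonZero p-prime}} dim

    Fixing𝟎 : Pred (W ↔ W) 0ℓ
    Fixing𝟎 = Stabilizer (Mem component) 𝟎

    -- A lift of `a` fixes `o`, since `ι` takes `𝟎` to `o`, and is therefore additive. Scalars act
    -- as repeated sums, so compatibility with them follows from additivity.
    fixing-linear : ∀ {a} → a ∈ Fixing𝟎 → LA.IsLinear a
    fixing-linear {a} ((g , g∈ , eq) , a𝟎) =
      (λ u v → ι-injective (begin
        ι (to a (u ⊕ v))              ≡⟨ eq _ ⟨
        to g (ι (u ⊕ v))              ≡⟨ cong (to g) (ι-⊕ u v) ⟩
        to g (ι u + ι v)              ≡⟨ g-+ _ _ ⟩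
        to g (ι u) + to g (ι v)       ≡⟨ cong₂ _+_ (eq u) (eq v) ⟩
        ι (to a u) + ι (to a v)       ≡⟨ ι-⊕ _ _ ⟨
        ι (to a u ⊕ to a v)           ∎)) ,
      (λ c v → ι-injective (begin
        ι (to a (c · v))              ≡⟨ eq _ ⟨
        to g (ι (c · v))              ≡⟨ cong (to g) (comb-· C.vectors c v) ⟩
        to g (toℕ c • ι v)            ≡⟨ additive-• g-+ (toℕ c) (ι v) ⟩
        toℕ c • to g (ι v)            ≡⟨ cong (toℕ c •_) (eq v) ⟩
        toℕ c • ι (to a v)            ≡⟨ comb-· C.vectors c _ ⟨
        ι (c · to a v)                ∎))
      where
      open ≡-Reasoning
      g-+ : Additive (to g)
      g-+ = linear g g∈ (trans (cong (to g) (sym ι-𝟎)) (trans (eq 𝟎) (trans (cong ι a𝟎) ι-𝟎)))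

    component-affine : ∀ h → h ∈ Mem component → LA.IsAffine h
    component-affine h h∈ with s , s∈ , s≡ ← shift (to h 𝟎) =
      ↔-sym s ↔-∘ h , to h 𝟎 ,
      fixing-linear {↔-sym s ↔-∘ h} (H.∘∈ {↔-sym s} {h} (H.inv∈ {s} s∈) h∈ ,
        trans (cong (from s) (sym (trans (s≡ 𝟎) (⊕-identityˡ _)))) (strictlyInverseʳ s 𝟎)) ,
      λ v → trans (sym (strictlyInverseˡ s (to h v))) (s≡ _)

    -- For an invariant subspace `U`, the points with all coordinates in `U` form a subgroup
    -- invariant under the stabilizer, by `acts-linearly`. It is trivial or everything, and the axis
    -- of the summand `i₀` transfers the alternative to `U`.
    component-irreducible : LA.Irreducible Fixing𝟎
    component-irreducible = record
      { nonzero    = let (x , x≢o) = nonzero i₀ in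
          ρ x , λ ρx → x≢o (trans (sym (ι-ρ x)) (trans (cong ι ρx) ι-𝟎))
      ; invariants = λ U subspace invariant → invariants U subspace invariant
      }
      where
      module _ (U : W → Bool) (subspace : LA.IsSubspace U)
               (invariant : ∀ a → a ∈ Fixing𝟎 → ∀ v → T (U v) → T (U (to a v))) where
        open LA.IsSubspace subspace
        inside? : ∀ x → Dec (∀ i → T (U (ρ′ i x)))
        inside? x = Fin.all? λ i → T? (U (ρ′ i x))
        B : A → Bool
        B x = does (inside? x)
        ∈B : ∀ {x} → (∀ i → T (U (ρ′ i x))) → T (B x)
        ∈B {x} = Equivalence.from (T-does (inside? x))
        B∈ : ∀ {x} → T (B x) → ∀ i → T (U (ρ′ i x))
        B∈ {x} = Equivalence.to (T-does (inside? x))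
        o∈ : T (B o)
        o∈ = ∈B λ i → subst (T ∘ U) (sym (ρ′-o i)) 𝟎∈
        +∈ : ∀ {x y} → T (B x) → T (B y) → T (B (x + y))
        +∈ s u = ∈B λ i → subst (T ∘ U) (sym (ρ′-+ i _ _)) (⊕∈ (B∈ s i) (B∈ u i))
        •∈ : ∀ n {x} → T (B x) → T (B (n • x))
        •∈ zero    s = o∈
        •∈ (suc n) s = +∈ s (•∈ n s)
        κ∈B : ∀ {κ} → κ ∈ Stab → ∀ {x} → T (B x) → T (B (to κ x))
        κ∈B {κ} κ∈ {x} s with l , _ , inter ← induced κ∈ = ∈B λ j →
          let (h , h∈ , h𝟎 , eq) = acts-linearly κ∈ (from l j) j
                (subst (Intertwines π κ (from l j)) (strictlyInverseˡ l j) (inter (from l j)))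
          in subst (T ∘ U) (sym (eq x)) (invariant h (h∈ , h𝟎) _ (B∈ s (from l j)))
        axis∈ : ∀ {v} → T (U v) → T (B (ι′ i₀ v))
        axis∈ {v} s = ∈B at
          where
          at : ∀ i → T (U (ρ′ i (ι′ i₀ v)))
          at i with i Fin.≟ i₀
          ... | yes refl = subst (T ∘ U) (sym (ρ′-ι′ i v)) s
          ... | no  i≢   = subst (T ∘ U) (sym (ρ′-ι′-other i i₀ i≢ v)) 𝟎∈
        invariants : (∀ v → T (U v) → v ≡ 𝟎) ⊎ (∀ v → T (U v))
        invariants = Sum.map
          (λ trivial v s → ι′-injective i₀ (trans (trivial _ (axis∈ s)) (sym (ι′-𝟎 i₀))))
          (λ all v → subst (T ∘ U) (ρ′-ι′ i₀ v) (B∈ (all (ι′ i₀ v)) i₀))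
          (invariant-subgroup prim B o∈ +∈
            -- Negation is multiplication by `p - 1`, so closure under sums suffices.
            (λ {x} s → subst (T ∘ B) (sym (neg-• x)) (•∈ (pred p) s)) κ∈B)

    closed-· : (U : W → Bool) → T (U 𝟎) → (∀ {u v} → T (U u) → T (U v) → T (U (u ⊕ v))) →
               ∀ c {v} → T (U v) → T (U (c · v))
    closed-· U 𝟎∈ ⊕∈ c {v} s = subst (T ∘ U)
      (ι-injective (trans (proj₁ (multiple (toℕ c))) (sym (comb-· C.vectors c v)))) (proj₂ (multiple (toℕ c)))
      where
      times : ℕ → W
      times zero    = 𝟎
      times (suc n) = v ⊕ times n
      multiple : ∀ n → ι (times n) ≡ n • ι v × T (U (times n))
      multiple zero    = ι-𝟎 , 𝟎∈
      multiple (suc n) = trans (ι-⊕ v _) (cong (ι v +_) (proj₁ (multiple n))) , ⊕∈ s (proj₂ (multiple n))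

    -- A block through α is the translate by α of an invariant subspace.
    component-primitive : Primitive component
    component-primitive = record
      { nontrivial = let (v , v≢𝟎) = LA.Irreducible.nonzero component-irreducible in v , 𝟎 , v≢𝟎
      ; transitive = component-transitive
      ; blocks     = blocks
      }
      where
      module _ (B : W → Bool) (block : ∀ g → g ∈ Mem component →
                 (∀ α → T (B α) ⇔ T (B (to g α))) ⊎ (∀ α → T (B α) → ¬ T (B (to g α))))
               (α : W) (α∈ : T (B α)) where
        s : W ↔ W
        s = proj₁ (shift α)
        s∈ : s ∈ Mem component
        s∈ = proj₁ (proj₂ (shift α))
        s≡ : ∀ v → to s v ≡ v ⊕ α
        s≡ = proj₂ (proj₂ (shift α))
        s𝟎 : to s 𝟎 ≡ α
        s𝟎 = trans (s≡ 𝟎) (⊕-identityˡ α)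
        stable : ∀ {h} → h ∈ Mem component → T (B (to h α)) → ∀ {v} → T (B v) → T (B (to h v))
        stable {h} h∈ hα∈ {v} v∈ with block h h∈
        ... | inj₁ same  = Equivalence.to (same v) v∈
        ... | inj₂ apart = contradiction hα∈ (apart α α∈)
        U : W → Bool
        U u = B (to s u)
        𝟎∈ : T (U 𝟎)
        𝟎∈ = subst (T ∘ B) (sym s𝟎) α∈
        ⊕∈ : ∀ {u v} → T (U u) → T (U v) → T (U (u ⊕ v))
        ⊕∈ {u} {v} u∈ v∈ with h , h∈ , h≡ ← shift u = subst (T ∘ B)
          (trans (h≡ _) (trans (cong (_⊕ u) (s≡ v)) (trans (⊕-comm _ u) (trans (sym (⊕-assoc u v α)) (sym (s≡ _))))))
          (stable {h} h∈ (subst (T ∘ B) (trans (s≡ u) (trans (⊕-comm u α) (sym (h≡ α)))) u∈) v∈)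
        subspace : LA.IsSubspace U
        subspace = record { 𝟎∈ = 𝟎∈ ; ⊕∈ = ⊕∈ ; ·∈ = closed-· U 𝟎∈ ⊕∈ }
        invariant : ∀ a → a ∈ Fixing𝟎 → ∀ v → T (U v) → T (U (to a v))
        invariant a (a∈ , a𝟎) v v∈ = subst (T ∘ B) (cong (to s ∘ to a) (strictlyInverseʳ s v))
          (stable {conjugate s a} (H.∘∈ {s} {a ↔-∘ ↔-sym s} s∈ (H.∘∈ {a} {↔-sym s} a∈ (H.inv∈ {s} s∈)))
            (subst (T ∘ B) (sym (trans (cong (to s ∘ to a) (trans (cong (from s) (sym s𝟎)) (strictlyInverseʳ s 𝟎)))
              (trans (cong (to s) a𝟎) s𝟎))) α∈) v∈)
        U∈ : ∀ {β} → T (B β) → T (U (from s β))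
        U∈ {β} = subst (T ∘ B) (sym (strictlyInverseˡ s β))
        cases : (∀ v → T (U v) → v ≡ 𝟎) ⊎ (∀ v → T (U v)) →
                (∀ β γ → T (B β) → T (B γ) → β ≡ γ) ⊎ (∀ β → T (B β))
        cases = Sum.map
          (λ trivial β γ β∈ γ∈ → trans (sym (strictlyInverseˡ s β)) (trans
            (cong (to s) (trans (trivial _ (U∈ β∈)) (sym (trivial _ (U∈ γ∈))))) (strictlyInverseˡ s γ)))
          (λ all β → subst (T ∘ B) (strictlyInverseˡ s β) (all (from s β)))
      blocks : ∀ B → IsBlock component B →
               (∀ α β → T (B α) → T (B β) → α ≡ β) ⊎ (∀ α → T (B α))
      blocks B ((α , α∈) , block) = cases B block α α∈
        (LA.Irreducible.invariants component-irreducible _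
          (subspace B block α α∈) (invariant B block α α∈))

    component-noSwap : (∀ {g α β} → g ∈ Mem G → to g α ≡ β → to g β ≡ α → α ≡ β) →
                       ∀ {h α β} → h ∈ Mem component → to h α ≡ β → to h β ≡ α → α ≡ β
    component-noSwap noSwap (g , g∈ , eq) hα hβ =
      ι-injective (noSwap g∈ (trans (eq _) (cong ι hα)) (trans (eq _) (cong ι hβ)))

    -- Refining the system by a decomposition of the component

    additive-∑ : ∀ {n} (F : W → A) → (∀ u v → F (u ⊕ v) ≡ F u + F v) → F 𝟎 ≡ o →
          (w : Fin n → W) → F (∑ w) ≡ sum (F ∘ w)
    additive-∑ {zero}  F F-⊕ F-𝟎 w = F-𝟎
    additive-∑ {suc n} F F-⊕ F-𝟎 w = trans (F-⊕ (w zero) _) (cong (F (w zero) +_) (additive-∑ F F-⊕ F-𝟎 (w ∘ suc)))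

    module Refinement {s : ℕ} {D : Fin s → W → Bool} (decomposition : LA.IsDecomposition D)
                      (permutes : LA.PermutesSummands Fixing𝟎 D) where
      private module D = LA.IsDecomposition decomposition

      σ : Fin s → W → W
      σ j v = proj₁ (D.spanning v) j

      σ∈ : ∀ j v → T (D j (σ j v))
      σ∈ j v = proj₁ (proj₂ (D.spanning v)) j

      ∑-σ : ∀ v → ∑ (λ j → σ j v) ≡ v
      ∑-σ v = proj₂ (proj₂ (D.spanning v))

      σ-unique : ∀ {v} (w : Fin s → W) → (∀ j → T (D j (w j))) → ∑ w ≡ v → ∀ j → σ j v ≡ w j
      σ-unique {v} w w∈ eq = D.unique _ w (λ j → σ∈ j v) w∈ (trans (∑-σ v) (sym eq))

      σ-⊕ : ∀ j u v → σ j (u ⊕ v) ≡ σ j u ⊕ σ j v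
      σ-⊕ j u v = σ-unique (λ i → σ i u ⊕ σ i v)
        (λ i → LA.IsSubspace.⊕∈ (D.subspace i) (σ∈ i u) (σ∈ i v))
        (ι-injective (begin
          ι (∑ λ i → σ i u ⊕ σ i v)                     ≡⟨ additive-∑ ι ι-⊕ ι-𝟎 (λ i → σ i u ⊕ σ i v) ⟩
          sum (λ i → ι (σ i u ⊕ σ i v))                 ≡⟨ sum-cong-≗ (λ i → ι-⊕ (σ i u) (σ i v)) ⟩
          sum (λ i → ι (σ i u) + ι (σ i v))             ≡⟨ ∑-distrib-+ (λ i → ι (σ i u)) (λ i → ι (σ i v)) ⟩
          sum (λ i → ι (σ i u)) + sum (λ i → ι (σ i v)) ≡⟨ cong₂ _+_ (additive-∑ ι ι-⊕ ι-𝟎 λ i → σ i u) (additive-∑ ι ι-⊕ ι-𝟎 λ i → σ i v) ⟨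
          ι (∑ λ i → σ i u) + ι (∑ λ i → σ i v)         ≡⟨ cong₂ (λ a b → ι a + ι b) (∑-σ u) (∑-σ v) ⟩
          ι u + ι v                                     ≡⟨ ι-⊕ u v ⟨
          ι (u ⊕ v)                                     ∎)) j
        where open ≡-Reasoning

      module _ {j : Fin s} {v : W} (v∈ : T (D j v)) where
        private
          w : Fin s → W
          w i with i Fin.≟ j
          ... | yes _ = v
          ... | no  _ = 𝟎

          w-j : w j ≡ v
          w-j with j Fin.≟ j
          ... | yes _  = refl
          ... | no j≢j = contradiction refl j≢j

          w-other : ∀ {i} → i ≢ j → w i ≡ 𝟎
          w-other {i} i≢j with i Fin.≟ j
          ... | yes i≡j = contradiction i≡j i≢j
          ... | no  _   = refl

          w∈ : ∀ i → T (D i (w i))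
          w∈ i with i Fin.≟ j
          ... | yes refl = v∈
          ... | no  _    = LA.IsSubspace.𝟎∈ (D.subspace i)

          ∑-w : ∑ w ≡ v
          ∑-w = ι-injective (begin
            ι (∑ w)       ≡⟨ additive-∑ ι ι-⊕ ι-𝟎 w ⟩
            sum (ι ∘ w)   ≡⟨ sum-single (ι ∘ w) j (λ i i≢j → trans (cong ι (w-other i≢j)) ι-𝟎) ⟩
            ι (w j)       ≡⟨ cong ι w-j ⟩
            ι v           ∎)
            where open ≡-Reasoning

        σ-same : σ j v ≡ v
        σ-same = trans (σ-unique w w∈ ∑-w j) w-j

        σ-other : ∀ {i} → i ≢ j → σ i v ≡ 𝟎
        σ-other {i} i≢j = trans (σ-unique w w∈ ∑-w i) (w-other i≢j)

      σ-𝟎 : ∀ j → σ j 𝟎 ≡ 𝟎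
      σ-𝟎 j = σ-same (LA.IsSubspace.𝟎∈ (D.subspace j))

      σ-joint : ∀ v → (∀ j → σ j v ≡ 𝟎) → v ≡ 𝟎
      σ-joint v eq = ι-injective (begin
        ι v                        ≡⟨ cong ι (∑-σ v) ⟨
        ι (∑ λ j → σ j v)          ≡⟨ additive-∑ ι ι-⊕ ι-𝟎 (λ j → σ j v) ⟩
        sum (λ j → ι (σ j v))      ≡⟨ sum-zero (λ j → ι (σ j v)) (λ j → trans (cong ι (eq j)) ι-𝟎) ⟩
        o                          ≡⟨ ι-𝟎 ⟨
        ι 𝟎                        ∎)
        where open ≡-Reasoning

      -- Applied to `v` as the sum of its components, the projection to the target of `j` after `a`
      -- keeps only the component `j`: distinct summands have distinct targets, as otherwise a
      -- nonzero vector would lie in two of them.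
      σ-permuted : ∀ {a} → a ∈ Fixing𝟎 → ∀ j → ∃ λ j′ → ∀ v → to a (σ j v) ≡ σ j′ (to a v)
      σ-permuted {a} a∈ j = target j , λ v → ι-injective (sym (begin
        ι (σ (target j) (to a v))                                   ≡⟨ cong F (∑-σ v) ⟨
        F (∑ λ i → σ i v)                                           ≡⟨ additive-∑ F F-⊕ F-𝟎 (λ i → σ i v) ⟩
        sum (λ i → F (σ i v))                                       ≡⟨ sum-single (λ i → F (σ i v)) j (λ i i≢j → trans
                                                                         (cong ι (σ-other (moved i (σ∈ i v)) (i≢j ∘ sym ∘ target-injective j i)))
                                                                         ι-𝟎) ⟩
        F (σ j v)                                                   ≡⟨ cong ι (σ-same (moved j (σ∈ j v))) ⟩
        ι (to a (σ j v))                                            ∎))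
        where
        open ≡-Reasoning
        target : Fin s → Fin s
        target i = proj₁ (permutes a a∈ i)
        moved : ∀ i {v} → T (D i v) → T (D (target i) (to a v))
        moved i {v} = Equivalence.to (proj₂ (permutes a a∈ i) v)
        target-injective : ∀ i k → target i ≡ target k → i ≡ k
        target-injective i k eq with v , v∈ , v≢𝟎 ← D.nonzero i with i Fin.≟ k
        ... | yes i≡k = i≡k
        ... | no  i≢k = contradiction (trans (sym (σ-same v∈)) (σ-other v∈k i≢k)) v≢𝟎
          where
          v∈k : T (D k v)
          v∈k = Equivalence.from (proj₂ (permutes a a∈ k) v) (subst (λ l → T (D l (to a v))) eq (moved i v∈))
        F : W → A
        F v = ι (σ (target j) (to a v))
        F-⊕ : ∀ u v → F (u ⊕ v) ≡ F u + F v
        F-⊕ u v = trans (cong ι (trans (cong (σ (target j)) (proj₁ (fixing-linear {a} a∈) u v)) (σ-⊕ (target j) _ _))) (ι-⊕ _ _)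
        F-𝟎 : F 𝟎 ≡ o
        F-𝟎 = trans (cong ι (trans (cong (σ (target j)) (proj₂ a∈)) (σ-𝟎 (target j)))) ι-𝟎

      refine : Fin t × Fin s → A → A
      refine (i , j) x = ι′ i (σ j (ρ′ i x))

      refined : Fin (t ℕ.* s) → A → A
      refined q = refine (remQuot s q)

      refine-orthogonal : ∀ i j i′ j′ → (i , j) ≢ (i′ , j′) → ∀ x → refine (i , j) (refine (i′ , j′) x) ≡ o
      refine-orthogonal i j i′ j′ neq x with i Fin.≟ i′
      ... | no i≢i′ = trans (cong (ι′ i) (trans (cong (σ j) (ρ′-ι′-other i i′ i≢i′ _)) (σ-𝟎 j))) (ι′-𝟎 i)
      ... | yes refl = trans (cong (ι′ i) (trans (cong (σ j) (ρ′-ι′ i _))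
        (σ-other (σ∈ j′ _) λ { refl → neq refl }))) (ι′-𝟎 i)

      at-combine : ∀ i j x → refined (combine i j) x ≡ refine (i , j) x
      at-combine i j x = cong (λ ij → refine ij x) (Fin.remQuot-combine i j)

      -- A stabilizer element sends the piece `(i , j)` to `(i′ , j′)`, where `i′` is the image of
      -- the summand `i` and `j′` is the image of `j` under the element of the component that
      -- `acts-linearly` provides. That element fixes `𝟎`, hence permutes the summands of `D`.
      refinement : IsSystem refined
      refinement = record
        { additive   = λ q x y → let (i , j) = remQuot {t} s q in
            trans (cong (ι′ i) (trans (cong (σ j) (ρ′-+ i x y)) (σ-⊕ j _ _))) (ι′-⊕ i _ _)
        ; idempotent = λ q x → let (i , j) = remQuot {t} s q in
            cong (ι′ i) (trans (cong (σ j) (ρ′-ι′ i _)) (σ-same (σ∈ j _)))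
        ; orthogonal = λ q q′ q≢q′ → refine-orthogonal _ _ _ _ λ eq → q≢q′
            (trans (sym (Fin.combine-remQuot {t} s q)) (trans (cong (uncurry combine) eq) (Fin.combine-remQuot {t} s q′)))
        ; joint      = λ x eq → ρ′-joint λ i → trans
            (σ-joint (ρ′ i x) λ j → ι′-injective i
              (trans (sym (at-combine i j x)) (trans (eq (combine i j)) (sym (ι′-𝟎 i)))))
            (sym (ρ′-o i))
        ; nonzero    = λ q → let (i , j) = remQuot {t} s q ; (v , v∈ , v≢𝟎) = D.nonzero j in
            ι′ i v , λ eq → v≢𝟎 (ι′-injective i
              (trans (cong (ι′ i) (sym (trans (cong (σ j) (ρ′-ι′ i v)) (σ-same v∈)))) (trans eq (sym (ι′-𝟎 i)))))
        ; permuted   = λ g g∈ go q → permuted′ g (g∈ , go) (remQuot {t} s q)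
        }
        where
        permuted′ : ∀ g → g ∈ Stab → ∀ ij → ∃ λ q′ → ∀ x → to g (refine ij x) ≡ refined q′ (to g x)
        permuted′ g g∈ (i , j) with i′ , inter ← permuted g (proj₁ g∈) (proj₂ g∈) i
                               with h , h∈ , h𝟎 , eq ← acts-linearly {g} g∈ i i′ inter
                               with j′ , σ-eq ← σ-permuted {h} (h∈ , h𝟎) j = combine i′ j′ , λ x → begin
          to g (ι′ i (σ j (ρ′ i x)))                ≡⟨ cong (to g) (ι′-inside i _) ⟨
          to g (π i (ι′ i (σ j (ρ′ i x))))          ≡⟨ inter _ ⟩
          π i′ (to g (ι′ i (σ j (ρ′ i x))))         ≡⟨ ι′-ρ′ i′ _ ⟨
          ι′ i′ (ρ′ i′ (to g (ι′ i (σ j (ρ′ i x))))) ≡⟨ cong (ι′ i′) (trans (eq _) (cong (to h) (ρ′-ι′ i _))) ⟩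
          ι′ i′ (to h (σ j (ρ′ i x)))               ≡⟨ cong (ι′ i′) (trans (σ-eq _) (cong (σ j′) (sym (eq x)))) ⟩
          ι′ i′ (σ j′ (ρ′ i′ (to g x)))             ≡⟨ at-combine i′ j′ (to g x) ⟨
          refined (combine i′ j′) (to g x)          ∎
          where open ≡-Reasoning

    -- A decomposition with `s > 1` summands would refine the system to `t * s` summands; this
    -- exceeds `t`, because the index `i₀` makes `t` positive.
    component-linearlyPrimitive : (∀ s → t < s → ¬ HasSystem s) → LA.IsPrimitiveLinear Fixing𝟎
    component-linearlyPrimitive maximal s 1<s D decomposition permutes =
      maximal (t ℕ.* s) (ℕ.m<m*n t s {{Fin.nonZeroIndex i₀}} 1<s) (refined , refinement)
      where open Refinement decomposition permutes

    Inv-linearlyPrimitive : Solvable G → (∀ s → t < s → ¬ HasSystem s) → LinearlyPrimitive (Inv component)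
    Inv-linearlyPrimitive solvable maximal = record
      { G               = component
      ; isPrimitive     = component-primitive
      ; isSolvable      = component-solvable solvable
      ; X≡InvG          = λ s → mk⇔ id id
      ; p               = p
      ; d               = dim
      ; prime           = p-prime
      ; φ               = ↔-id W
      ; affine          = component-affine
      ; translations    = shift
      ; irreducible     = component-irreducible
      ; linearPrimitive = component-linearlyPrimitive maximal
      }

    -- The antisymmetric case

    module _ (noSwap : ∀ {g α β} → g ∈ Mem G → to g α ≡ β → to g β ≡ α → α ≡ β) where

      -- If 2m is a period of x, then the m-th power swaps x and its image, so m is a period.
      odd-period : ∀ {g} → g ∈ Mem G → ∀ x → ∃ λ m → to (power g (suc (m ℕ.+ m))) x ≡ x
      odd-period {g} g∈ x with n , eq ← period g x = halve (suc n) (<-wellFounded (suc n)) (s≤s z≤n) eq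
        where
        halve : ∀ n → Acc _<_ n → 0 < n → to (power g n) x ≡ x → ∃ λ m → to (power g (suc (m ℕ.+ m))) x ≡ x
        halve n (acc rs) 0<n eq with parity n
        ... | m , inj₂ refl = m , eq
        ... | suc m , inj₁ refl = halve (suc m) (rs (ℕ.m<m+n (suc m) (s≤s z≤n))) (s≤s z≤n)
          (sym (noSwap (power-∈ g∈ (suc m)) refl (trans (sym (power-+ g (suc m) (suc m) x)) eq)))

      -- Let `g` induce `l`. A point of the summand `i` is fixed by some odd power of `g`, while odd
      -- powers of `g` move that summand to the summand `to l i`. The point lies in both, so if
      -- these differ it is `o`.
      top-noInvolution : ∀ l → l ∈ Mem top → (∀ i → to l (to l i) ≡ i) → ∀ i → to l i ≡ i
      top-noInvolution l (g , g∈ , go , inter) involutive i with w , w≢o ← nonzero i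
        with m , eq ← odd-period g∈ (π i w) with to l i Fin.≟ i
      ... | yes li≡i = li≡i
      ... | no  li≢i = contradiction (begin
        π i w                                          ≡⟨ eq ⟨
        to (power g (suc (m ℕ.+ m))) (π i w)           ≡⟨ cong (to (power g (suc (m ℕ.+ m)))) (idempotent i w) ⟨
        to (power g (suc (m ℕ.+ m))) (π i (π i w))     ≡⟨ cong (to g) (even m (π i w)) ⟩
        to g (π i (to (power g (m ℕ.+ m)) (π i w)))    ≡⟨ inter i _ ⟩
        π (to l i) (to (power g (suc (m ℕ.+ m))) (π i w)) ≡⟨ cong (π (to l i)) eq ⟩
        π (to l i) (π i w)                             ≡⟨ orthogonal (to l i) i li≢i w ⟩
        o                                              ∎) w≢o
        where
        open ≡-Reasoning
        even : ∀ m → Intertwines π (power g (m ℕ.+ m)) i i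
        even zero    x = refl
        even (suc m) x rewrite ℕ.+-suc m m = begin
          to g (to g (to (power g (m ℕ.+ m)) (π i x)))   ≡⟨ cong (to g ∘ to g) (even m x) ⟩
          to g (to g (π i (to (power g (m ℕ.+ m)) x)))   ≡⟨ cong (to g) (inter i _) ⟩
          to g (π (to l i) (to g (to (power g (m ℕ.+ m)) x))) ≡⟨ inter (to l i) _ ⟩
          π (to l (to l i)) (to g (to g (to (power g (m ℕ.+ m)) x))) ≡⟨ cong (λ j → π j _) (involutive i) ⟩
          π i (to g (to g (to (power g (m ℕ.+ m)) x)))   ∎

theorem6p1 : (Ω : FiniteSet) (G : PermGroup (Carrier Ω)) → Primitive G → Solvable G →
    Σ[ X′ ∈ RelationSet (Carrier Ω) ]
    Σ[ Γ ∈ FiniteSet ] Σ[ Y ∈ RelationSet (Carrier Γ) ]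
    Σ[ m ∈ ℕ ] Σ[ L ∈ PermGroup (Fin m) ]
    IsFusion Ω X′ (Inv G)
    × Isomorphic X′ (Y ↑ L)
    × IsScheme Γ Y
    × LinearlyPrimitive Y
    × Transitive L
    × (Antisymmetric Ω (Inv G) → Antisymmetric Γ Y × OddOrder L)
theorem6p1 Ω G prim solv with o , plus , table ← translationTable Ω G prim solv
  with p , p-prime , torsion ← Affine.elementary Ω G o plus table prim
  with Affine.maximalSystem Ω G o plus table prim
-- A system without summands would make every point equal to `o`; the case `suc` supplies the index
-- `zero` used as `i₀`.
... | zero , (π , system) , _ = contradiction (Affine.IsSystem.joint system _ λ ())
        (proj₂ (Affine.nonzero-point Ω G o plus table prim))
... | t@(suc _) , (π , system) , maximal =
  Inv Ĝ , Γ , Inv component , t , top ,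
  Inv-fusion Ω G Ĝ (λ {g} → G⊆Ĝ {g}) ,
  Inv-wreath Ω Γ component top split ,
  Inv-scheme Γ component component-transitive (ρ o) ,
  Inv-linearlyPrimitive solv maximal ,
  top-transitive ,
  λ antisymmetric → let noSwap = λ {g} {α} {β} → Inv-antisymmetric⇒noSwap Ω G antisymmetric {g} {α} {β} in
    noSwap⇒Inv-antisymmetric Γ component (λ {h} → component-noSwap noSwap {h}) ,
    noInvolution⇒oddOrder (finSet t) top (top-noInvolution noSwap)
  where
  open Affine Ω G o plus table using (module System; module Frame)
  open System system using (top)
  open Frame prim p p-prime torsion system zero
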